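{- There exists an infinite sequence $(\Gamma_n)_{n=1}^\infty$ of CNF formulas such that $\Gamma_n$ admits $\mathsf{SBC}^-$ proofs of size $n^{O(1)}$ but requires $\mathsf{GER}^-$ proofs of size $2^{\Omega(n)}$.
   Context: A literal is a propositional variable or its negation; $\overline{p}$ is the complement of $p$, and $\overline{L}=\{\overline{p} : p\in L\}$ for a set $L$ of literals. A set of literals is tautological if it contains some $x$ and $\overline{x}$. A clause is a finite nontautological set of literals (read as a disjunction); $\bot$ is the empty clause. A CNF is a finite set of clauses; $\mathrm{var}(\Gamma)$ is the set of variables occurring in $\Gamma$. "Proof" of $\Gamma$ means refutation. Resolution. If $A\cup\{x\}$ and $B\cup\{\overline{x}\}$ are clauses with $x$ a variable not occurring in $A$ or $B$, and $A\cup B$ is a clause, then $A\cup B$ is their resolvent on $x$. A weakening of a clause $A$ is any clause $A\cup B$. A resolution proof of $\Gamma$ is a sequence $\Pi=(\Gamma_1,\dots,\Gamma_N)$ of CNFs with $\Gamma_1=\Gamma$, $\bot\in\Gamma_N$, and each $\Gamma_{i+1}=\Gamma_i\cup\{C\}$, where $C$ is a resolvent of two clauses of $\Gamma_i$ or a weakening of a clause of $\Gamma_i$. Its size is $|\Pi|=N$. SBC. A clause $C$ is a set-blocked clause (SBC) for a nonempty $L\subseteq C$ with respect to $\Gamma$ if for every $D\in\Gamma$ with $D\cap\overline{L}\neq\varnothing$ and $D\cap L=\varnothing$ the set $(C\setminus L)\cup(D\setminus\overline{L})$ is tautological. $C$ is an SBC with respect to $\Gamma$ if it is one for some nonempty $L\subseteq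 C$. An $\mathsf{SBC}$ proof of $\Gamma$ is defined like a resolution proof, except that each added clause $C$ may also be any SBC with respect to the current CNF $\Gamma_i$; its size is $N$. An $\mathsf{SBC}^-$ proof of $\Gamma$ is an $\mathsf{SBC}$ proof in which only variables of $\mathrm{var}(\Gamma)$ occur. GER. A clause $C=\{p\}\cup C'$ (variable of $p$ not in $C'$) is blocked for $p$ with respect to $\Gamma$ if for every $D\in\Gamma$ of the form $\{\overline{p}\}\cup D'$ (variable of $p$ not in $D'$) the set $C'\cup D'$ is tautological; $C$ is blocked with respect to $\Gamma$ if it is so for some $p\in C$. The kernel $\ker(\Gamma)$ is the CNF obtained from $\Gamma$ by repeatedly removing a clause that is blocked with respect to the current set, until no clause of the current set is blocked with respect to it (the result does not depend on the order of removal). A CNF $\Lambda$ is a blocked extension for $\Gamma$ if $\ker(\Gamma\cup\Lambda)=\ker(\Gamma)$. A $\mathsf{GER}$ proof of $\Gamma$ is a pair $(\Lambda,\Pi)$ where $\Lambda$ is a blocked extension for $\Gamma$ and $\Pi$ is a resolution proof of $\Gamma\cup\Lambda$; its size is $|\Lambda|+|\Pi|$, where $|\Lambda|$ is the number of clauses. It is a $\mathsf{GER}^-$ proof if $\mathrm{var}(\Lambda)\subseteq\mathrm{var}(\Gamma)$. -}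

module Defs where

open import Data.List.Base using (List; []; _∷_; _++_; map; concatMap; filter; length; deduplicate)
open import Data.List.Membership.Propositional using (_∈_; _∉_)
open import Data.List.Relation.Binary.Disjoint.Propositional using (Disjoint)
open import Data.List.Relation.Binary.Subset.Propositional using (_⊆_)
open import Data.List.Relation.Binary.Subset.Propositional.Properties using (⊆-refl; ⊆-trans)
import Data.List.Membership.DecPropositional as DecMembership
import Data.List.Membership.Setoid as SetoidMembership
import Data.List.Relation.Binary.Subset.DecPropositional as DecSubset
import Data.List.Relation.Binary.Subset.Setoid as SetoidSubset
open import Data.Nat.Base using (ℕ; suc; _+_)
import Data.Nat.Properties as ℕ
open import Data.Product.Base using (∃; ∃₂; _×_; _,_; proj₁; proj₂; swap)
open import Data.Vec.Base using (Vec; []; _∷_)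
open import Data.Vec.Relation.Unary.All using (All)
open import Level using (0ℓ)
open import Relation.Binary.Bundles using (DecSetoid)
open import Relation.Binary.Construct.Closure.ReflexiveTransitive using (Star)
open import Relation.Binary.Definitions using (DecidableEquality; Decidable)
open import Relation.Binary.PropositionalEquality using (_≡_; refl; cong)
open import Relation.Nullary.Decidable using (yes; no; ¬?; map′; _×-dec_)
open import Relation.Nullary.Negation using (¬_)

------------------------------------------------------------------------
-- Literals and finite sets of literals

Var : Set
Var = ℕ

data Literal : Set where
  pos neg : Var → Literal

var : Literal → Var
var (pos x) = x
var (neg x) = x

complement : Literal → Literal
complement (pos x) = neg x
complement (neg x) = pos x

_≟ˡ_ : DecidableEquality Literal
pos x ≟ˡ pos y = map′ (cong pos) (λ { refl → refl }) (x ℕ.≟ y)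
pos x ≟ˡ neg y = no λ ()
neg x ≟ˡ pos y = no λ ()
neg x ≟ˡ neg y = map′ (cong neg) (λ { refl → refl }) (x ℕ.≟ y)

-- A finite set is represented by a list enumerating it, possibly with
-- repetitions.  Union is _++_, and equality of sets is mutual inclusion.
LitSet : Set
LitSet = List Literal

infix 4 _≐_

_≐_ : LitSet → LitSet → Set
S ≐ T = S ⊆ T × T ⊆ S

open DecMembership _≟ˡ_ using (_∈?_)
open DecSubset _≟ˡ_ using (_⊆?_)

_∖_ : LitSet → LitSet → LitSet
S ∖ T = filter (λ l → ¬? (l ∈? T)) S

complements : LitSet → LitSet
complements = map complement

litVars : LitSet → List Var
litVars = map var

Tautological : LitSet → Set
Tautological S = ∃ λ x → pos x ∈ S × neg x ∈ S

------------------------------------------------------------------------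
-- Clauses and CNFs

record Clause : Set where
  constructor clause
  field
    lits    : LitSet
    nontaut : ¬ Tautological lits

open Clause public

⊥ᶜ : Clause
⊥ᶜ = clause [] λ ()

_≟ᶜ_ : Decidable (λ C D → lits C ≐ lits D)
C ≟ᶜ D = (lits C ⊆? lits D) ×-dec (lits D ⊆? lits C)

clauseDecSetoid : DecSetoid 0ℓ 0ℓ
clauseDecSetoid = record
  { Carrier          = Clause
  ; _≈_              = λ C D → lits C ≐ lits D
  ; isDecEquivalence = record
    { isEquivalence = record
      { refl  = ⊆-refl , ⊆-refl
      ; sym   = swap
      ; trans = λ (a , b) (c , d) → ⊆-trans a c , ⊆-trans d b
      }
    ; _≟_ = _≟ᶜ_
    }
  }

CNF : Set
CNF = List Clause

open SetoidMembership (DecSetoid.setoid clauseDecSetoid) public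
  using () renaming (_∈_ to _∈ᶜ_)
open SetoidSubset (DecSetoid.setoid clauseDecSetoid) public
  using () renaming (_⊆_ to _⊆ᶜ_)

infix 4 _≐ᶜ_

_≐ᶜ_ : CNF → CNF → Set
Γ ≐ᶜ Δ = Γ ⊆ᶜ Δ × Δ ⊆ᶜ Γ

_-_ : CNF → Clause → CNF
Γ - C = filter (λ D → ¬? (C ≟ᶜ D)) Γ

-- The number of clauses: those equal as sets are counted once.
∣_∣ : CNF → ℕ
∣ Γ ∣ = length (deduplicate _≟ᶜ_ Γ)

vars : CNF → List Var
vars = concatMap (λ C → litVars (lits C))

------------------------------------------------------------------------
-- Proof sequences

-- E is the resolvent of C = A ∪ {x} and D = B ∪ {x̄}.
Resolvent : Clause → Clause → Clause → Set
Resolvent C D E = ∃ λ x → ∃₂ λ A B →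
  x ∉ litVars A × x ∉ litVars B ×
  lits C ≐ pos x ∷ A × lits D ≐ neg x ∷ B × lits E ≐ A ++ B

Weakening : Clause → Clause → Set
Weakening C E = lits C ⊆ lits E

SetBlockedFor : LitSet → Clause → CNF → Set
SetBlockedFor L C Γ = ∀ D → D ∈ᶜ Γ →
  (∃ λ l → l ∈ lits D × l ∈ complements L) → Disjoint (lits D) L →
  Tautological ((lits C ∖ L) ++ (lits D ∖ complements L))

SetBlocked : Clause → CNF → Set
SetBlocked C Γ = ∃ λ L →
  (∃ λ l → l ∈ L) × L ⊆ lits C × SetBlockedFor L C Γ

-- A rule R says which clauses may be added to the current CNF.
Rule : Set₁
Rule = CNF → Clause → Set

data ResolutionRule (Γ : CNF) (E : Clause) : Set where
  resolve : ∀ {C D} → C ∈ᶜ Γ → D ∈ᶜ Γ → Resolvent C D E → ResolutionRule Γ E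
  weaken  : ∀ {C} → C ∈ᶜ Γ → Weakening C E → ResolutionRule Γ E

data SBCRule (Γ : CNF) (E : Clause) : Set where
  resolution : ResolutionRule Γ E → SBCRule Γ E
  setBlocked : SetBlocked E Γ → SBCRule Γ E

-- Proof R Γ N consists of the proofs (Γ₁, …, Γ_N) of Γ = Γ₁ under the rule R;
-- the index N is the size, i.e. the number of CNFs in the sequence.
data Proof (R : Rule) (Γ : CNF) : ℕ → Set where
  done : ⊥ᶜ ∈ᶜ Γ → Proof R Γ 1
  add  : ∀ {N} C → R Γ C → Proof R (C ∷ Γ) N → Proof R Γ (suc N)

sequence : ∀ {R Γ N} → Proof R Γ N → Vec CNF N
sequence {Γ = Γ} (done _)    = Γ ∷ []
sequence {Γ = Γ} (add _ _ π) = Γ ∷ sequence π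

ResolutionProof : CNF → ℕ → Set
ResolutionProof = Proof ResolutionRule

SBCProof : CNF → ℕ → Set
SBCProof = Proof SBCRule

SBC⁻Proof : CNF → ℕ → Set
SBC⁻Proof Γ N = ∃ λ (π : SBCProof Γ N) →
  All (λ Δ → vars Δ ⊆ vars Γ) (sequence π)

------------------------------------------------------------------------
-- Blocked clauses, kernels and GER

BlockedFor : Literal → Clause → CNF → Set
BlockedFor p C Γ = ∃ λ C′ →
  var p ∉ litVars C′ × lits C ≐ p ∷ C′ ×
  (∀ D → D ∈ᶜ Γ → ∀ D′ → var p ∉ litVars D′ → lits D ≐ complement p ∷ D′ →
   Tautological (C′ ++ D′))

Blocked : Clause → CNF → Set
Blocked C Γ = ∃ λ p → BlockedFor p C Γ

data _⟶_ (Γ : CNF) : CNF → Set where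
  remove : ∀ {C} → C ∈ᶜ Γ → Blocked C Γ → Γ ⟶ (Γ - C)

-- The kernel is given as a relation: K is the outcome of some exhaustive
-- removal of blocked clauses from Γ.  Any two outcomes are equal up to _≐ᶜ_.
IsKernel : CNF → CNF → Set
IsKernel Γ K = Star _⟶_ Γ K × (∀ C → C ∈ᶜ K → ¬ Blocked C K)

BlockedExtension : CNF → CNF → Set
BlockedExtension Γ Λ = ∃₂ λ K K′ →
  IsKernel (Γ ++ Λ) K × IsKernel Γ K′ × K ≐ᶜ K′

record GERProof (Γ : CNF) : Set where
  field
    Λ                : CNF
    blockedExtension : BlockedExtension Γ Λ
    N                : ℕ
    Π                : ResolutionProof (Γ ++ Λ) N

  size : ℕ
  size = ∣ Λ ∣ + N

record GER⁻Proof (Γ : CNF) : Set where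
  field
    gerProof : GERProof Γ

  open GERProof gerProof public

  field
    noNewVars : vars Λ ⊆ vars Γ

{-# OPTIONS --safe #-}
module Submission where

-- The formulas are the pigeonhole principles with 4n holes.
--
-- Lower bound.  A critical assignment places all pigeons but one bijectively in
-- the holes.  Flipping one of its variables always falsifies a clause of the
-- formula that this variable alone satisfied, so a clause over the same variables
-- that is blocked holds under every critical assignment.  A blocked extension is
-- therefore invisible to the argument of Beame and Pitassi.  With respect to
-- critical assignments a clause is monotone, given by a set of edges.  If no
-- clause has many edges, then every derived clause can be falsified only while
-- omitting one of few pigeons, and the empty clause is out of reach.  If there
-- are few clauses with many edges, then repeatedly setting the most frequent
-- edge makes all of them true.
--
-- Upper bound.  Without loss of generality pigeon k sits in hole k: if it sits
-- alone in hole j, and pigeon i alone in hole k, exchange the two.  The clause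
-- excluding this situation is set-blocked, and remains so in the presence of all
-- such clauses of earlier stages, because each of them that an exchange touches
-- also contains a literal that the exchange makes true.

open import Defs
import Algebra.Properties.Semiring.Sum as SemiringSum
open import Data.Bool.Base using (Bool; true; false; T; not; _∧_; if_then_else_)
open import Data.Bool.ListAction using (any)
open import Data.Empty using (⊥; ⊥-elim)
open import Data.Fin.Base
  using (Fin; zero; suc; punchIn; punchOut; combine; remQuot; toℕ; inject₁; fromℕ; fromℕ<)
open import Data.Fin.Permutation
  using (Permutation′; _⟨$⟩ʳ_; _⟨$⟩ˡ_; _∘ₚ_; insert; insert-punchIn; transpose; inverseʳ; inverseˡ)
open import Data.Fin.Properties as Fin
  using ( punchIn-injective; punchInᵢ≢i; punchIn-punchOut; combine-injective; remQuot-combine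
        ; toℕ-injective; toℕ<n; toℕ-fromℕ<; toℕ-fromℕ; toℕ-inject₁)
open import Data.List.Base
  using (List; []; _∷_; _++_; map; length; allFin; cartesianProduct; filter)
import Data.List.Membership.DecPropositional as DecMembership
open import Data.List.Membership.Propositional using (_∈_; _∉_; find; lose)
open import Data.List.Membership.Propositional.Properties
  using ( ∈-map⁺; ∈-map⁻; ∈-++⁺ˡ; ∈-++⁺ʳ; ∈-++⁻; ∈-filter⁺; ∈-filter⁻; ∈-allFin
        ; ∈-cartesianProduct⁺; ∈-concatMap⁺; ∈-concatMap⁻)
open import Data.List.Properties using (length-map; length-++; length-tabulate; length-filter)
open import Data.List.Relation.Binary.Subset.Propositional using (_⊆_)
open import Data.List.Relation.Unary.Any as Any using (Any; here; there)
import Data.List.Relation.Unary.Any.Properties as Any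
open import Data.Maybe.Base using (Maybe; just; nothing)
open import Data.Nat.Base
open import Data.Nat.DivMod using (_mod_; m<n⇒m%n≡m)
open import Data.Nat.ListAction using () renaming (sum to sumˡ)
open import Data.Nat.Properties
open import Data.Nat.Tactic.RingSolver using (solve-∀)
open import Data.Product.Base using (Σ; ∃; ∃₂; _×_; _,_; proj₁; proj₂)
open import Data.Sum.Base as Sum using (_⊎_; inj₁; inj₂; [_,_]′)
import Data.Vec.Relation.Unary.All as Vec
open import Function.Base using (_∘_; id)
open import Relation.Binary.Construct.Closure.ReflexiveTransitive using (Star; ε; _◅_)
open import Relation.Binary.PropositionalEquality
open import Relation.Nullary.Decidable
  using (Dec; yes; no; does; ¬?; _×-dec_; dec-true; dec-false; ¬¬-excluded-middle)
open import Relation.Nullary.Negation using (¬_; contradiction)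

open DecMembership _≟ˡ_ using (_∈?_)
open SemiringSum +-*-semiring
  using (sum; sum-cong-≗; sum-remove; ∑-comm; ∑-distrib-+; sum-permute; *-distribʳ-sum; *-distribˡ-sum)

-- Monotone clauses over matchings

indicator : Bool → ℕ
indicator true  = 1
indicator false = 0

sum-mono-≤ : ∀ {n} {f g : Fin n → ℕ} → (∀ i → f i ≤ g i) → sum f ≤ sum g
sum-mono-≤ {zero}  f≤g = z≤n
sum-mono-≤ {suc n} f≤g = +-mono-≤ (f≤g zero) (sum-mono-≤ (f≤g ∘ suc))

sum-const : ∀ n c → sum {n} (λ _ → c) ≡ n * c
sum-const zero    c = refl
sum-const (suc n) c = cong (c +_) (sum-const n c)

sum-punchIn-≤ : ∀ {n} (i : Fin (suc n)) (f : Fin (suc n) → ℕ) → sum (f ∘ punchIn i) ≤ sum f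
sum-punchIn-≤ i f = subst (sum (f ∘ punchIn i) ≤_) (sym (sum-remove {i = i} f)) (m≤n+m _ (f i))

sum≤n*max : ∀ {n} (f : Fin (suc n) → ℕ) → ∃ λ i → sum f ≤ suc n * f i
sum≤n*max {zero}  f = zero , ≤-refl
sum≤n*max {suc n} f with sum≤n*max (f ∘ suc)
... | i , le with ≤-total (f zero) (f (suc i))
...   | inj₁ f₀≤fᵢ = suc i , +-mono-≤ f₀≤fᵢ le
...   | inj₂ fᵢ≤f₀ = zero , +-monoʳ-≤ (f zero) (≤-trans le (*-monoʳ-≤ (suc n) fᵢ≤f₀))

sum-singleton : ∀ {n} (i₀ : Fin n) → sum (λ i → indicator (does (i Fin.≟ i₀))) ≡ 1
sum-singleton {suc n} zero     = cong suc (trans (sum-const n 0) (*-zeroʳ n))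
sum-singleton {suc n} (suc i₀) = trans (sum-cong-≗ {n} λ i → refl) (sum-singleton i₀)

indicator-complement : ∀ {n} (W : Fin n → Bool) →
  sum (indicator ∘ W) + sum (indicator ∘ not ∘ W) ≡ n
indicator-complement {n} W = begin
  sum (indicator ∘ W) + sum (indicator ∘ not ∘ W)           ≡⟨ ∑-distrib-+ (indicator ∘ W) (indicator ∘ not ∘ W) ⟨
  sum (λ i → indicator (W i) + indicator (not (W i)))       ≡⟨ sum-cong-≗ (λ i → one (W i)) ⟩
  sum {n} (λ _ → 1)                                         ≡⟨ sum-const n 1 ⟩
  n * 1                                                     ≡⟨ *-identityʳ n ⟩
  n                                                         ∎
  where
  open ≡-Reasoning
  one : ∀ b → indicator b + indicator (not b) ≡ 1
  one true  = refl
  one false = refl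

-- Which pigeons can be left out is settled only classically. Staying under double negation is
-- harmless, as the result serves to refute the absence of wide clauses.
¬¬-decide : ∀ {n} (P : Fin n → Set) → ¬ ¬ (∀ i → Dec (P i))
¬¬-decide {zero}  P k = k λ ()
¬¬-decide {suc n} P k =
  ¬¬-excluded-middle λ P₀? → ¬¬-decide (P ∘ suc) λ P? → k λ { zero → P₀? ; (suc i) → P? i }

-- A critical assignment to m holes and m + 1 pigeons is a permutation: hole
-- suc j receives its value, and the pigeon at the dummy hole zero is left out.
Critical : ℕ → Set
Critical m = Permutation′ (suc m)

Edges : ℕ → Set
Edges m = Fin m → Fin (suc m) → Bool

-- The monotone form of a clause lists the edges that satisfy it; nothing is a
-- clause already satisfied by the edges chosen so far.
MClause : ℕ → Set
MClause m = Maybe (Edges m)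

private variable
  m : ℕ

Falsifies : Critical m → MClause m → Set
Falsifies π nothing  = ⊥
Falsifies π (just M) = ∀ j → M j (π ⟨$⟩ʳ suc j) ≡ false

-- Semantic on purpose: a pigeon clause is falsified only when its own pigeon is left out, while a
-- hole clause or a blocked clause over the same variables is never falsified. Restriction preserves
-- the property.
Axiom : MClause m → Set
Axiom c = ∀ π ρ → Falsifies π c → Falsifies ρ c → π ⟨$⟩ʳ zero ≡ ρ ⟨$⟩ʳ zero

Premise : List (MClause m) → MClause m → Set
Premise cs c = Axiom c ⊎ c ∈ cs

-- A step need only be sound on critical assignments. Resolution has this form, and weakening is the
-- case of two equal premises.
data Derivation {m} : List (MClause m) → Set where
  []   : Derivation []
  step : ∀ {cs a b} c → Premise cs a → Premise cs b →
         (∀ π → Falsifies π c → Falsifies π a ⊎ Falsifies π b) →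
         Derivation cs → Derivation (c ∷ cs)

edge : MClause m → Fin m → Fin (suc m) → Bool
edge nothing  j i = false
edge (just M) j i = M j i

width : MClause m → ℕ
width c = sum λ j → sum λ i → indicator (edge c j i)

swapHoles : Critical m → Fin m → Critical m
swapHoles π j = transpose zero (suc j) ∘ₚ π

swapHoles-suc : (π : Critical m) (j : Fin m) → swapHoles π j ⟨$⟩ʳ suc j ≡ π ⟨$⟩ʳ zero
swapHoles-suc π j rewrite dec-true (suc j Fin.≟ suc j) refl = refl

swapHoles-other : (π : Critical m) {j k : Fin m} → k ≢ j →
                  swapHoles π j ⟨$⟩ʳ suc k ≡ π ⟨$⟩ʳ suc k
swapHoles-other π {j} {k} k≢j rewrite dec-false (suc k Fin.≟ suc j) (k≢j ∘ Fin.suc-injective) = refl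

-- Moving the omitted pigeon of π into hole j changes the truth value of M only
-- through the edge between them.
swapped-edge : (π : Critical m) (M : Edges m) (j : Fin m) →
  Falsifies π (just M) → ¬ Falsifies (swapHoles π j) (just M) → M j (π ⟨$⟩ʳ zero) ≡ true
swapped-edge π M j π-fals ¬fals with M j (π ⟨$⟩ʳ zero) in eq
... | true  = refl
... | false = contradiction fals ¬fals
  where
  fals : Falsifies (swapHoles π j) (just M)
  fals k = at (k Fin.≟ j)
    where
    at : Dec (k ≡ j) → M k (swapHoles π j ⟨$⟩ʳ suc k) ≡ false
    at (yes refl) = trans (cong (M j) (swapHoles-suc π j)) eq
    at (no k≢j)   = trans (cong (M k) (swapHoles-other π k≢j)) (π-fals k)

-- Omittable pigeons and narrow clauses

Omittable : MClause m → Fin (suc m) → Set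
Omittable c i = ∃ λ π → Falsifies π c × π ⟨$⟩ʳ zero ≡ i

module _ (c : MClause m) (omittable? : ∀ i → Dec (Omittable c i)) where

  private
    W : Fin (suc m) → Bool
    W = does ∘ omittable?

    w v : ℕ
    w = sum (indicator ∘ W)
    v = sum (indicator ∘ not ∘ W)

  -- Let `π` falsify `c` and omit `i`. Moving `i` into a hole whose pigeon is not omittable must
  -- satisfy `c`, and only the edge between `i` and that hole can do this. There are `v` such holes.
  row-bound : ∀ i → indicator (W i) * v ≤ sum (λ j → indicator (edge c j i))
  row-bound i with omittable? i
  ... | no _ = z≤n
  ... | yes (π , fals , refl) = begin
    v + 0                                                ≡⟨ +-identityʳ v ⟩
    v                                                    ≡⟨ sum-permute (indicator ∘ not ∘ W) π ⟩
    indicator (not (W (π ⟨$⟩ʳ zero))) + sum (λ j → indicator (not (W (π ⟨$⟩ʳ suc j))))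
      -- The dummy hole contributes nothing: its pigeon is omittable, as `π` shows.
      ≡⟨ cong (λ b → indicator (not b) + sum (λ j → indicator (not (W (π ⟨$⟩ʳ suc j)))))
              (dec-true (omittable? (π ⟨$⟩ʳ zero)) (π , fals , refl)) ⟩
    sum (λ j → indicator (not (W (π ⟨$⟩ʳ suc j))))       ≤⟨ sum-mono-≤ edges ⟩
    sum (λ j → indicator (edge c j (π ⟨$⟩ʳ zero)))       ∎
    where
    open ≤-Reasoning
    edges-of : ∀ c′ → Falsifies π c′ → ∀ j → ¬ Omittable c′ (π ⟨$⟩ʳ suc j) → edge c′ j (π ⟨$⟩ʳ zero) ≡ true
    edges-of (just M) fals j ¬om = swapped-edge π M j fals (λ f → ¬om (swapHoles π j , f , refl))

    edges : ∀ j → indicator (not (W (π ⟨$⟩ʳ suc j))) ≤ indicator (edge c j (π ⟨$⟩ʳ zero))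
    edges j with omittable? (π ⟨$⟩ʳ suc j)
    ... | yes _  = z≤n
    ... | no ¬om = ≤-reflexive (cong indicator (sym (edges-of c fals j ¬om)))

  w*v≤width : w * v ≤ width c
  w*v≤width = begin
    w * v                                                  ≡⟨ *-distribʳ-sum v (indicator ∘ W) ⟩
    sum (λ i → indicator (W i) * v)                        ≤⟨ sum-mono-≤ row-bound ⟩
    sum (λ i → sum (λ j → indicator (edge c j i)))         ≡⟨ ∑-comm (λ i j → indicator (edge c j i)) ⟩
    width c                                                ∎
    where
    open ≤-Reasoning

-- The complexity measure of Beame and Pitassi: `V` is a weighted set of pigeons covering all that
-- can be left out when `c` is falsified.
Narrow : ℕ → MClause m → Set
Narrow t c = ∃ λ V → sum V ≤ t × (∀ π → Falsifies π c → 1 ≤ V (π ⟨$⟩ʳ zero))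

axiom-narrow : ∀ {t} {c : MClause m} → 1 ≤ t → Axiom c → ¬ ¬ Narrow t c
axiom-narrow {m} {t} {c} 1≤t ax k = ¬¬-excluded-middle {A = ∃ λ π → Falsifies π c} λ
  { (yes (π , fals)) → k ( (λ i → indicator (does (i Fin.≟ (π ⟨$⟩ʳ zero))))
                         , ≤-trans (≤-reflexive (sum-singleton (π ⟨$⟩ʳ zero))) 1≤t
                         , λ ρ fals′ → ≤-reflexive (cong indicator (sym (dec-true (_ Fin.≟ _) (ax ρ π fals′ fals)))))
  ; (no ¬fals)       → k ( (λ _ → 0) , ≤-trans (≤-reflexive (trans (sum-const (suc m) 0) (*-zeroʳ m))) z≤n
                         , λ π fals → contradiction (π , fals) ¬fals)
  }

-- A gap argument. The omittable pigeons of `c` are covered by `A` and `B`, so `w` is at most `2t`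
-- and at least `t` pigeons are not omittable. If `w` exceeded `t`, then `w*v≤width` would yield
-- `t * t` edges.
derived-narrow : ∀ {t} {a b c : MClause m} → 3 * t ≤ m →
  (∀ π → Falsifies π c → Falsifies π a ⊎ Falsifies π b) →
  width c < t * t → Narrow t a → Narrow t b → ¬ ¬ Narrow t c
derived-narrow {m} {t} {a} {b} {c} 3t≤m split c-thin (A , A≤t , A-hit) (B , B≤t , B-hit) k =
  ¬¬-decide (Omittable c) λ omittable? →
  let
    W = does ∘ omittable?
    w = sum (indicator ∘ W)
    v = sum (indicator ∘ not ∘ W)

    W≤A+B : ∀ i → indicator (W i) ≤ A i + B i
    W≤A+B i = weight (omittable? i)

    w≤2t : w ≤ t + t
    w≤2t = ≤-trans (sum-mono-≤ W≤A+B) (≤-trans (≤-reflexive (∑-distrib-+ A B)) (+-mono-≤ A≤t B≤t))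

    w+v≡ : w + v ≡ suc m
    w+v≡ = indicator-complement W

    t≤v : t ≤ v
    t≤v = +-cancelˡ-≤ (t + t) t v (begin
      t + t + t       ≡⟨ three t ⟩
      3 * t           ≤⟨ 3t≤m ⟩
      m               ≤⟨ n≤1+n m ⟩
      suc m           ≡⟨ w+v≡ ⟨
      w + v           ≤⟨ +-monoˡ-≤ v w≤2t ⟩
      t + t + v       ∎)
  in
  k ( indicator ∘ W
    , ≮⇒≥ (λ t<w → <⇒≱ c-thin (≤-trans (*-mono-≤ (<⇒≤ t<w) t≤v) (w*v≤width c omittable?)))
    , λ π fals → ≤-reflexive (cong indicator (sym (dec-true (omittable? _) (π , fals , refl)))))
  where
  open ≤-Reasoning
  three : ∀ t → t + t + t ≡ 3 * t
  three = solve-∀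

  weight : ∀ {i} (d : Dec (Omittable c i)) → indicator (does d) ≤ A i + B i
  weight (no _)                   = z≤n
  weight (yes (π , fals , refl)) with split π fals
  ... | inj₁ a-fals = ≤-trans (A-hit π a-fals) (m≤m+n _ _)
  ... | inj₂ b-fals = ≤-trans (B-hit π b-fals) (m≤n+m _ _)

-- Wide clauses in a refutation

wide : ℕ → MClause m → ℕ
wide t c = indicator (t * t ≤ᵇ width c)

wides : ℕ → List (MClause m) → ℕ
wides t cs = sumˡ (map (wide t) cs)

wide-mono : ∀ {m n t} (c : MClause m) (d : MClause n) → width c ≤ width d → wide t c ≤ wide t d
wide-mono {t = t} c d c≤d with t * t ≤ᵇ width c in t²≤c | t * t ≤ᵇ width d in t²≤d
... | false | _     = z≤n
... | true  | true  = ≤-refl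
... | true  | false =
  contradiction (≤-trans (≤ᵇ⇒≤ (t * t) _ (subst T (sym t²≤c) _)) c≤d)
                (λ t²≤width → subst T t²≤d (≤⇒≤ᵇ t²≤width))

killed-thin : ∀ {t} → 1 ≤ t → wide t (nothing {A = Edges m}) ≡ 0
killed-thin {m} {suc t} 1≤t rewrite sum-const (suc m) 0 | *-zeroʳ m | sum-const m 0 | *-zeroʳ m = refl

¬wide⇒thin : ∀ t (c : MClause m) → wide t c ≡ 0 → width c < t * t
¬wide⇒thin t c eq with t * t ≤ᵇ width c in le
... | false = ≰⇒> λ le′ → subst T le (≤⇒≤ᵇ le′)

module _ {t : ℕ} (1≤t : 1 ≤ t) (3t≤m : 3 * t ≤ m) where

  -- Induction along the derivation: axioms are narrow, and without wide clauses `derived-narrow`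
  -- applies at each step.
  premise-narrow : ∀ {cs c} → Derivation {m} cs → wides t cs ≡ 0 → Premise cs c → ¬ ¬ Narrow t c
  member-narrow  : ∀ {cs c} → Derivation {m} cs → wides t cs ≡ 0 → c ∈ cs → ¬ ¬ Narrow t c

  premise-narrow d none (inj₁ ax)   = axiom-narrow 1≤t ax
  premise-narrow d none (inj₂ c∈cs) = member-narrow d none c∈cs

  member-narrow (step {cs} c a b split d) none (there c∈cs) =
    member-narrow d (m+n≡0⇒n≡0 (wide t c) none) c∈cs
  member-narrow (step {cs} c a b split d) none (here refl) k =
    premise-narrow d none′ a λ a-narrow →
    premise-narrow d none′ b λ b-narrow →
    derived-narrow 3t≤m split (¬wide⇒thin t c (m+n≡0⇒m≡0 (wide t c) none)) a-narrow b-narrow k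
    where
    none′ : wides t cs ≡ 0
    none′ = m+n≡0⇒n≡0 (wide t c) none

  -- A clause falsified everywhere would allow each of the `m + 1` pigeons to be left out, through
  -- `transpose zero i`, which exceeds the weight `t`.
  narrow-satisfiable : ∀ {c} → Narrow t c → ¬ (∀ (π : Critical m) → Falsifies π c)
  narrow-satisfiable (V , V≤t , hit) fals = <-irrefl refl (begin-strict
    m                        ≡⟨ *-identityʳ m ⟨
    m * 1                    ≡⟨ sum-const m 1 ⟨
    sum {m} (λ _ → 1)        <⟨ n<1+n _ ⟩
    sum {suc m} (λ _ → 1)    ≤⟨ sum-mono-≤ (λ i → hit (transpose zero i) (fals (transpose zero i))) ⟩
    sum V                    ≤⟨ V≤t ⟩
    t                        ≤⟨ m≤m+n t _ ⟩
    3 * t                    ≤⟨ 3t≤m ⟩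
    m                        ∎)
    where open ≤-Reasoning

  refutation-wide : ∀ {cs c} → Derivation {m} cs → Premise cs c → (∀ π → Falsifies π c) →
                    1 ≤ wides t cs
  refutation-wide d c fals = n≢0⇒n>0 λ none →
    premise-narrow d none c λ narrow → narrow-satisfiable narrow fals

-- Restriction: placing pigeon `i` in hole `j` for good

restrict : Fin (suc m) → Fin (suc (suc m)) → MClause (suc m) → MClause m
restrict j i nothing  = nothing
restrict j i (just M) = if M j i then nothing else just λ k l → M (punchIn j k) (punchIn i l)

module _ (j : Fin (suc m)) (i : Fin (suc (suc m))) where

  extend : Critical m → Critical (suc m)
  extend = insert (suc j) i

  extend-at : ∀ π → extend π ⟨$⟩ʳ suc j ≡ i
  extend-at π with j Fin.≟ j
  ... | yes _  = refl
  ... | no j≢j = contradiction refl j≢j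

  extend-punchIn : ∀ π k → extend π ⟨$⟩ʳ punchIn (suc j) k ≡ punchIn i (π ⟨$⟩ʳ k)
  extend-punchIn = insert-punchIn (suc j) i

  -- A restricted clause behaves at `π` as the original does at `extend π`. Together with the
  -- converse this carries axioms, steps and refutations to the smaller instance.
  restrict-falsifies⁻ : ∀ c π → Falsifies π (restrict j i c) → Falsifies (extend π) c
  restrict-falsifies⁻ (just M) π fals k with M j i in eq
  ... | false = at (j Fin.≟ k)
    where
    at : Dec (j ≡ k) → M k (extend π ⟨$⟩ʳ suc k) ≡ false
    at (yes refl) = trans (cong (M j) (extend-at π)) eq
    at (no j≢k)   = begin
      M k (extend π ⟨$⟩ʳ suc k)               ≡⟨ cong (λ k → M k (extend π ⟨$⟩ʳ suc k)) (Fin.punchIn-punchOut j≢k) ⟨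
      M k′ (extend π ⟨$⟩ʳ suc k′)             ≡⟨ cong (M k′) (extend-punchIn π (suc (punchOut j≢k))) ⟩
      M k′ (punchIn i (π ⟨$⟩ʳ suc (punchOut j≢k)))  ≡⟨ fals (punchOut j≢k) ⟩
      false                                   ∎
      where
      open ≡-Reasoning
      k′ = punchIn j (punchOut j≢k)

  restrict-falsifies⁺ : ∀ c π → Falsifies (extend π) c → Falsifies π (restrict j i c)
  restrict-falsifies⁺ (just M) π fals with M j i in eq
  ... | true  = contradiction (trans (sym eq) (trans (cong (M j) (sym (extend-at π))) (fals j))) λ ()
  ... | false = λ k → trans (cong (M (punchIn j k)) (sym (extend-punchIn π (suc k)))) (fals (punchIn j k))

  restrict-axiom : ∀ c → Axiom c → Axiom (restrict j i c)
  restrict-axiom c ax π ρ π-fals ρ-fals = punchIn-injective i _ _ (begin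
    punchIn i (π ⟨$⟩ʳ zero)     ≡⟨ extend-punchIn π zero ⟨
    extend π ⟨$⟩ʳ zero          ≡⟨ ax _ _ (restrict-falsifies⁻ c π π-fals) (restrict-falsifies⁻ c ρ ρ-fals) ⟩
    extend ρ ⟨$⟩ʳ zero          ≡⟨ extend-punchIn ρ zero ⟩
    punchIn i (ρ ⟨$⟩ʳ zero)     ∎)
    where open ≡-Reasoning

  restrict-premise : ∀ {cs c} → Premise cs c → Premise (map (restrict j i) cs) (restrict j i c)
  restrict-premise {c = c} = Sum.map (restrict-axiom c) (∈-map⁺ (restrict j i))

  restrict-derivation : ∀ {cs} → Derivation cs → Derivation (map (restrict j i) cs)
  restrict-derivation [] = []
  restrict-derivation (step {a = a} {b} c a∈ b∈ split d) =
    step (restrict j i c) (restrict-premise a∈) (restrict-premise b∈)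
      (λ π → Sum.map (restrict-falsifies⁺ a π) (restrict-falsifies⁺ b π)
             ∘ split (extend π) ∘ restrict-falsifies⁻ c π)
      (restrict-derivation d)

  restrict-width : ∀ M → width (just λ k l → M (punchIn j k) (punchIn i l)) ≤ width (just M)
  restrict-width M = begin
    (sum λ k → sum λ l → indicator (M (punchIn j k) (punchIn i l)))
      ≤⟨ sum-mono-≤ (λ k → sum-punchIn-≤ i (λ l → indicator (M (punchIn j k) l))) ⟩
    (sum λ k → sum λ l → indicator (M (punchIn j k) l))
      ≤⟨ sum-punchIn-≤ j (λ k → sum λ l → indicator (M k l)) ⟩
    (sum λ k → sum λ l → indicator (M k l))                           ∎
    where open ≤-Reasoning

  -- A wide clause containing the edge becomes true and is no longer wide; any other clause can only
  -- lose edges. The threshold `t` stays fixed while holes disappear.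
  restrict-wide : ∀ {t} → 1 ≤ t → ∀ c →
    wide t (restrict j i c) + wide t c * indicator (edge c j i) ≤ wide t c
  restrict-wide {t} 1≤t nothing = ≤-reflexive (begin
    wide t (nothing {A = Edges m}) + wide t (nothing {A = Edges (suc m)}) * 0
      ≡⟨ cong₂ _+_ (killed-thin {m} 1≤t) (*-zeroʳ (wide t (nothing {A = Edges (suc m)}))) ⟩
    0
      ≡⟨ killed-thin {suc m} 1≤t ⟨
    wide t (nothing {A = Edges (suc m)})                              ∎)
    where open ≡-Reasoning
  restrict-wide {t} 1≤t (just M) with M j i
  ... | true  = ≤-reflexive (cong₂ _+_ (killed-thin {m} 1≤t) (*-identityʳ (wide t (just M))))
  ... | false = begin
    wide t M′ + wide t (just M) * 0    ≡⟨ cong (wide t M′ +_) (*-zeroʳ (wide t (just M))) ⟩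
    wide t M′ + 0                      ≡⟨ +-identityʳ _ ⟩
    wide t M′                          ≤⟨ wide-mono {t = t} M′ (just M) (restrict-width M) ⟩
    wide t (just M)                    ∎
    where
    open ≤-Reasoning
    M′ = just λ k l → M (punchIn j k) (punchIn i l)

  hits : ℕ → List (MClause (suc m)) → ℕ
  hits t cs = sumˡ (map (λ c → wide t c * indicator (edge c j i)) cs)

  restrict-wides : ∀ {t} → 1 ≤ t → ∀ cs → wides t (map (restrict j i) cs) + hits t cs ≤ wides t cs
  restrict-wides 1≤t []       = z≤n
  restrict-wides {t} 1≤t (c ∷ cs) = begin
    wide t c′ + wides t cs′ + (wide t c * indicator (edge c j i) + hits t cs)
      ≡⟨ interchange (wide t c′) (wides t cs′) _ (hits t cs) ⟩
    wide t c′ + wide t c * indicator (edge c j i) + (wides t cs′ + hits t cs)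
      ≤⟨ +-mono-≤ (restrict-wide 1≤t c) (restrict-wides 1≤t cs) ⟩
    wide t c + wides t cs                                             ∎
    where
    open ≤-Reasoning
    c′  = restrict j i c
    cs′ = map (restrict j i) cs
    interchange : ∀ a b c d → a + b + (c + d) ≡ a + c + (b + d)
    interchange = solve-∀

-- Averaging: the most frequent edge

sum-hits : ∀ t (cs : List (MClause (suc m))) →
  wides t cs * (t * t) ≤ sum λ j → sum λ i → hits j i t cs
sum-hits t []       = z≤n
sum-hits t (c ∷ cs) = begin
  (wide t c + wides t cs) * (t * t)
    ≡⟨ *-distribʳ-+ (t * t) (wide t c) (wides t cs) ⟩
  wide t c * (t * t) + wides t cs * (t * t)
    ≤⟨ +-mono-≤ (wide*≤ (t * t ≤ᵇ width c) (≤ᵇ⇒≤ _ _)) (sum-hits t cs) ⟩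
  wide t c * width c + (sum λ j → sum λ i → hits j i t cs)
    ≡⟨ cong (_+ (sum λ j → sum λ i → hits j i t cs))
            (trans (*-distribˡ-sum (wide t c) (λ j → sum λ i → indicator (edge c j i)))
                   (sum-cong-≗ λ j → *-distribˡ-sum (wide t c) λ i → indicator (edge c j i))) ⟩
  (sum λ j → sum λ i → wide t c * indicator (edge c j i)) + (sum λ j → sum λ i → hits j i t cs)
    ≡⟨ ∑-distrib-+ (λ j → sum λ i → wide t c * indicator (edge c j i)) (λ j → sum λ i → hits j i t cs) ⟨
  (sum λ j → (sum λ i → wide t c * indicator (edge c j i)) + (sum λ i → hits j i t cs))
    ≡⟨ sum-cong-≗ (λ j → sym (∑-distrib-+ (λ i → wide t c * indicator (edge c j i)) (λ i → hits j i t cs))) ⟩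
  (sum λ j → sum λ i → hits j i t (c ∷ cs))                           ∎
  where
  open ≤-Reasoning
  wide*≤ : ∀ {x y} b → (T b → x ≤ y) → indicator b * x ≤ indicator b * y
  wide*≤ true  x≤y = *-monoʳ-≤ 1 (x≤y _)
  wide*≤ false _   = z≤n

-- Each wide clause has at least `t * t` edges. There are at most `4t` holes and, absorbing the
-- extra pigeon by `1≤t`, at most `5t` pigeons, hence at most `20 * (t * t)` edges in all.
frequent-edge : ∀ {t} → 1 ≤ t → suc m ≤ 4 * t → (cs : List (MClause (suc m))) →
  ∃₂ λ j i → wides t cs ≤ 20 * hits j i t cs
frequent-edge {m} {t} 1≤t m<4t cs
  with sum≤n*max (λ j → sum λ i → hits j i t cs)
... | j , j-max with sum≤n*max (λ i → hits j i t cs)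
...   | i , i-max = j , i , *-cancelʳ-≤ _ _ (t * t) {{m*n≢0 t t {{>-nonZero 1≤t}} {{>-nonZero 1≤t}}}} (begin
  wides t cs * (t * t)                          ≤⟨ sum-hits t cs ⟩
  (sum λ j → sum λ i → hits j i t cs)           ≤⟨ j-max ⟩
  suc m * (sum λ i → hits j i t cs)             ≤⟨ *-monoʳ-≤ (suc m) i-max ⟩
  suc m * (suc (suc m) * hits j i t cs)         ≤⟨ *-mono-≤ m<4t (*-monoˡ-≤ (hits j i t cs) (+-mono-≤ 1≤t m<4t)) ⟩
  4 * t * ((t + 4 * t) * hits j i t cs)         ≡⟨ square t (hits j i t cs) ⟩
  20 * hits j i t cs * (t * t)                  ∎)
  where
  open ≤-Reasoning
  square : ∀ t h → 4 * t * ((t + 4 * t) * h) ≡ 20 * h * (t * t)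
  square = solve-∀

drop-fraction : ∀ a {w w′ h} → w ≤ suc a * h → w′ + h ≤ w → suc a * w′ ≤ a * w
drop-fraction a {w} {w′} {h} w≤ w′+h≤w = +-cancelˡ-≤ w (suc a * w′) (a * w) (begin
  w + suc a * w′                ≤⟨ +-monoˡ-≤ (suc a * w′) w≤ ⟩
  suc a * h + suc a * w′        ≡⟨ *-distribˡ-+ (suc a) h w′ ⟨
  suc a * (h + w′)              ≡⟨ cong (suc a *_) (+-comm h w′) ⟩
  suc a * (w′ + h)              ≤⟨ *-monoʳ-≤ (suc a) w′+h≤w ⟩
  suc a * w                     ∎)
  where open ≤-Reasoning

decay : ∀ a b p q {w w′} → p ≤ q * w′ → b * w′ ≤ a * w → b * p ≤ a * q * w
decay a b p q {w} {w′} p≤ w′≤ = begin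
  b * p             ≤⟨ *-monoʳ-≤ b p≤ ⟩
  b * (q * w′)      ≡⟨ x∙yz≈y∙xz b q w′ ⟩
  q * (b * w′)      ≤⟨ *-monoʳ-≤ q w′≤ ⟩
  q * (a * w)       ≡⟨ xy∙z≈y∙xz a q w ⟨
  a * q * w         ∎
  where
  open ≤-Reasoning
  x∙yz≈y∙xz : ∀ x y z → x * (y * z) ≡ y * (x * z)
  x∙yz≈y∙xz = solve-∀
  xy∙z≈y∙xz : ∀ x y z → x * y * z ≡ y * (x * z)
  xy∙z≈y∙xz = solve-∀

-- Setting the most frequent edge removes a twentieth of the wide clauses; after
-- k steps 3t holes remain, and then a wide clause must still be present.
refutation-wides : ∀ {t} k {cs c} → 1 ≤ t → k ≤ t → Derivation {k + 3 * t} cs →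
  Premise cs c → (∀ π → Falsifies π c) → 20 ^ k ≤ 19 ^ k * wides t cs
refutation-wides {t} zero {cs} 1≤t k≤t d c∈ fals =
  ≤-trans (refutation-wide 1≤t ≤-refl d c∈ fals) (≤-reflexive (sym (+-identityʳ (wides t cs))))
refutation-wides {t} (suc k) {cs} {c} 1≤t k≤t d c∈ fals =
  let j , i , frequent = frequent-edge 1≤t (+-monoˡ-≤ (3 * t) k≤t) cs in
  decay 19 20 (20 ^ k) (19 ^ k) {wides t cs} {wides t (map (restrict j i) cs)}
    (refutation-wides k 1≤t (<⇒≤ k≤t) (restrict-derivation j i d)
      (restrict-premise j i c∈) (λ π → restrict-falsifies⁺ j i c π (fals (extend j i π))))
    (drop-fraction 19 {wides t cs} {wides t (map (restrict j i) cs)} {hits j i t cs} frequent (restrict-wides j i 1≤t cs))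

wides≤length : ∀ t (cs : List (MClause m)) → wides t cs ≤ length cs
wides≤length t []       = z≤n
wides≤length t (c ∷ cs) = +-mono-≤ (indicator≤1 (t * t ≤ᵇ width c)) (wides≤length t cs)
  where
  indicator≤1 : ∀ b → indicator b ≤ 1
  indicator≤1 true  = ≤-refl
  indicator≤1 false = z≤n

^-distribʳ-* : ∀ n x y → (x * y) ^ n ≡ x ^ n * y ^ n
^-distribʳ-* zero    x y = refl
^-distribʳ-* (suc n) x y = trans (cong (x * y *_) (^-distribʳ-* n x y)) (interchange x y (x ^ n) (y ^ n))
  where
  interchange : ∀ a b c d → a * b * (c * d) ≡ a * c * (b * d)
  interchange = solve-∀

-- The `d`-th power raises the growth rate `b / a` to at least 2; cancelling `a ^ (d * t)` avoids
-- fractions.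
power-amplify : ∀ a b d t {N} .{{_ : NonZero a}} → a ^ d * 2 ≤ b ^ d → b ^ t ≤ a ^ t * N → 2 ^ t ≤ N ^ d
power-amplify a b d t {N} gap le = *-cancelˡ-≤ (a ^ (d * t)) {{m^n≢0 a (d * t)}} (begin
  a ^ (d * t) * 2 ^ t        ≡⟨ cong (_* 2 ^ t) (^-*-assoc a d t) ⟨
  (a ^ d) ^ t * 2 ^ t        ≡⟨ ^-distribʳ-* t (a ^ d) 2 ⟨
  (a ^ d * 2) ^ t            ≤⟨ ^-monoˡ-≤ t gap ⟩
  (b ^ d) ^ t                ≡⟨ trans (^-*-assoc b d t) (trans (cong (b ^_) (*-comm d t)) (sym (^-*-assoc b t d))) ⟩
  (b ^ t) ^ d                ≤⟨ ^-monoˡ-≤ d le ⟩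
  (a ^ t * N) ^ d            ≡⟨ ^-distribʳ-* d (a ^ t) N ⟩
  (a ^ t) ^ d * N ^ d        ≡⟨ cong (_* N ^ d) (trans (^-*-assoc a t d) (cong (a ^_) (*-comm t d))) ⟩
  a ^ (d * t) * N ^ d        ∎)
  where open ≤-Reasoning

refutation-length : ∀ t {cs c} → 1 ≤ t → Derivation {4 * t} cs → Premise cs c →
  (∀ π → Falsifies π c) → 2 ^ t ≤ length cs ^ 14
-- `14` is the least exponent at which the power of `20 / 19` reaches 2, checked by evaluation.
-- `4 * t` unfolds to `t + 3 * t`, which leaves room for `t` restrictions.
refutation-length t {cs} 1≤t d c∈ fals = power-amplify 19 20 14 t (≤ᵇ⇒≤ (19 ^ 14 * 2) (20 ^ 14) _)
  (≤-trans (refutation-wides t 1≤t ≤-refl d c∈ fals) (*-monoʳ-≤ (19 ^ t) (wides≤length t cs)))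

-- Blocked clauses and the pigeonhole principle

≐-refl : ∀ {S} → S ≐ S
≐-refl = id , id

≐-sym : ∀ {S T} → S ≐ T → T ≐ S
≐-sym (S⊆T , T⊆S) = T⊆S , S⊆T

≐-trans : ∀ {S T U} → S ≐ T → T ≐ U → S ≐ U
≐-trans (S⊆T , T⊆S) (T⊆U , U⊆T) = T⊆U ∘ S⊆T , T⊆S ∘ U⊆T

-- Has Γ (lits C) is C ∈ᶜ Γ.
Has : CNF → LitSet → Set
Has Γ S = Any (λ D → S ≐ lits D) Γ

has-resp-≐ : ∀ {Γ S T} → S ≐ T → Has Γ S → Has Γ T
has-resp-≐ S≐T = Any.map (≐-trans (≐-sym S≐T))

has-clause : ∀ {Γ S} → Has Γ S → ∃ λ C → C ∈ᶜ Γ × S ≐ lits C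
has-clause h with find h
... | C , C∈Γ , S≐C = C , lose C∈Γ ≐-refl , S≐C

clashing : ∀ {S l} → l ∈ S → complement l ∈ S → Tautological S
clashing {l = pos v} l∈ l̄∈ = v , l∈ , l̄∈
clashing {l = neg v} l∈ l̄∈ = v , l̄∈ , l∈

same-var : ∀ {l p} → var l ≡ var p → l ≡ p ⊎ l ≡ complement p
same-var {pos _} {pos _} refl = inj₁ refl
same-var {pos _} {neg _} refl = inj₂ refl
same-var {neg _} {pos _} refl = inj₂ refl
same-var {neg _} {neg _} refl = inj₁ refl

pos-injective : ∀ {u v} → pos u ≡ pos v → u ≡ v
pos-injective refl = refl

neg-injective : ∀ {u v} → neg u ≡ neg v → u ≡ v
neg-injective refl = refl

vars⁻ : ∀ {Γ v} → v ∈ vars Γ → ∃ λ C → C ∈ Γ × v ∈ litVars (lits C)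
vars⁻ {Γ} v∈ = find (∈-concatMap⁻ (λ C → litVars (lits C)) {xs = Γ} v∈)

vars⁺ : ∀ {Γ C v} → C ∈ Γ → v ∈ litVars (lits C) → v ∈ vars Γ
vars⁺ C∈ v∈ = ∈-concatMap⁺ (λ C → litVars (lits C)) (lose C∈ v∈)

-- The pigeonhole formulas

module _ {m : ℕ} where

  x : Fin (suc m) → Fin m → Var
  x r j = toℕ (combine r j)

  x-injective : ∀ r j s k → x r j ≡ x s k → r ≡ s × j ≡ k
  x-injective r j s k eq = combine-injective r j s k (toℕ-injective eq)

  pigeonLits : Fin (suc m) → LitSet
  pigeonLits r = map (λ j → pos (x r j)) (allFin m)

  ∈-pigeonLits⁻ : ∀ r {l} → l ∈ pigeonLits r → ∃ λ j → l ≡ pos (x r j)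
  ∈-pigeonLits⁻ r l∈ with ∈-map⁻ _ l∈
  ... | j , _ , refl = j , refl

  ∈-pigeonLits⁺ : ∀ r j → pos (x r j) ∈ pigeonLits r
  ∈-pigeonLits⁺ r j = ∈-map⁺ (λ j → pos (x r j)) (∈-allFin j)

  holeLits : Fin (suc m) → Fin (suc m) → Fin m → LitSet
  holeLits r s j = neg (x r j) ∷ neg (x s j) ∷ []

  pigeonClause : Fin (suc m) → Clause
  pigeonClause r = clause (pigeonLits r) consistent
    where
    consistent : ¬ Tautological (pigeonLits r)
    consistent (_ , _ , n∈) with ∈-pigeonLits⁻ r n∈
    ... | _ , ()

  -- `punchIn r s′` runs through the pigeons other than `r`, so distinctness is built in; each pair
  -- of pigeons occurs in both orders.
  holeClause : Fin (suc m) × Fin m × Fin m → Clause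
  holeClause (r , s′ , j) = clause (holeLits r (punchIn r s′) j)
    λ { (_ , here () , _) ; (_ , there (here ()) , _) ; (_ , there (there ()) , _) }

php : ℕ → CNF
php m = map pigeonClause (allFin (suc m)) ++
        map holeClause (cartesianProduct (allFin (suc m)) (cartesianProduct (allFin m) (allFin m)))

module _ {m : ℕ} where

  ∈-pigeonClause : ∀ r → pigeonClause {m} r ∈ php m
  ∈-pigeonClause r = ∈-++⁺ˡ (∈-map⁺ pigeonClause (∈-allFin r))

  php-pigeon : ∀ (r : Fin (suc m)) → Has (php m) (pigeonLits r)
  php-pigeon r = lose (∈-pigeonClause r) ≐-refl

  php-hole : ∀ {r s : Fin (suc m)} j → r ≢ s → Has (php m) (holeLits r s j)
  php-hole {r} {s} j r≢s = lose
    (∈-++⁺ʳ (map pigeonClause (allFin (suc m)))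
      (∈-map⁺ holeClause
        (∈-cartesianProduct⁺ (∈-allFin r) (∈-cartesianProduct⁺ (∈-allFin (punchOut r≢s)) (∈-allFin j)))))
    (subst (λ s → holeLits r s j ≐ holeLits r (punchIn r (punchOut r≢s)) j) (punchIn-punchOut r≢s) ≐-refl)

  data Shape (S : LitSet) : Set where
    pigeon : ∀ r → S ≐ pigeonLits {m} r → Shape S
    hole   : ∀ r s j → r ≢ s → S ≐ holeLits {m} r s j → Shape S

  php-shape : ∀ {S} → Has (php m) S → Shape S
  php-shape h with find h
  ... | C , C∈ , S≐C with ∈-++⁻ (map pigeonClause (allFin (suc m))) C∈
  ...   | inj₁ C∈ᵖ with ∈-map⁻ (pigeonClause {m}) {xs = allFin (suc m)} C∈ᵖ
  ...     | r , _ , refl = pigeon r S≐C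
  php-shape h | C , C∈ , S≐C | inj₂ C∈ʰ with ∈-map⁻ holeClause C∈ʰ
  ...     | (r , s′ , j) , _ , refl = hole r (punchIn r s′) j (punchInᵢ≢i r s′ ∘ sym) S≐C

  shape-vars : ∀ {S l} → Shape S → l ∈ S → ∃₂ λ r j → var l ≡ x {m} r j
  shape-vars (pigeon r S≐) l∈ with ∈-pigeonLits⁻ r (proj₁ S≐ l∈)
  ... | j , refl = r , j , refl
  shape-vars (hole r s j _ S≐) l∈ with proj₁ S≐ l∈
  ... | here refl         = r , j , refl
  ... | there (here refl) = s , j , refl

  php-vars⁻ : ∀ {v} → v ∈ vars (php m) → ∃₂ λ r j → v ≡ x {m} r j
  php-vars⁻ v∈ with vars⁻ v∈
  ... | C , C∈ , v∈C with ∈-map⁻ var v∈C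
  ...   | l , l∈C , refl = shape-vars (php-shape (lose C∈ ≐-refl)) l∈C

  php-vars⁺ : ∀ r j → x {m} r j ∈ vars (php m)
  php-vars⁺ r j = vars⁺ (∈-pigeonClause r) (∈-map⁺ var (∈-pigeonLits⁺ r j))

value : (Var → Bool) → Literal → Bool
value θ (pos v) = θ v
value θ (neg v) = not (θ v)

Falsified : (Var → Bool) → LitSet → Set
Falsified θ S = ∀ {l} → l ∈ S → value θ l ≡ false

-- An assignment falsifying a clause blocked for p is a witness that the clauses
-- containing the complement of p stay satisfied when p is made true.
blocked-witness : ∀ {Γ C p θ} → BlockedFor p C Γ → Falsified θ (lits C) →
  ∀ D → D ∈ᶜ Γ → complement p ∈ lits D →
  ∃ λ l → l ∈ lits D × l ≢ complement p × value θ l ≡ true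
blocked-witness {Γ} {C} {p} {θ} (C′ , p∉C′ , C≐ , blocked) fals D D∈Γ p̄∈D
  with blocked D D∈Γ D′ p∉D′ D≐
  where
  D′ = filter (λ l → ¬? (l ≟ˡ complement p)) (lits D)

  p∉D′ : var p ∉ litVars D′
  p∉D′ v∈ with ∈-map⁻ var v∈
  ... | l , l∈D′ , eq with ∈-filter⁻ (λ l → ¬? (l ≟ˡ complement p)) l∈D′
  ...   | l∈D , l≢p̄ with same-var {l} {p} (sym eq)
  ...     | inj₁ refl = nontaut D (clashing l∈D p̄∈D)
  ...     | inj₂ l≡p̄  = l≢p̄ l≡p̄

  D≐ : lits D ≐ complement p ∷ D′
  D≐ = split , λ { (here refl) → p̄∈D ; (there l∈) → proj₁ (∈-filter⁻ (λ l → ¬? (l ≟ˡ complement p)) l∈) }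
    where
    split : lits D ⊆ complement p ∷ D′
    split {l} l∈ with l ≟ˡ complement p
    ... | yes refl = here refl
    ... | no l≢p̄   = there (∈-filter⁺ (λ l → ¬? (l ≟ˡ complement p)) l∈ l≢p̄)
... | v , v∈ , v̄∈ = true-literal (θ v) refl
  where
  in-D : ∀ {l} → value θ l ≡ true →
         l ∈ C′ ++ filter (λ l → ¬? (l ≟ˡ complement p)) (lits D) →
         ∃ λ l → l ∈ lits D × l ≢ complement p × value θ l ≡ true
  in-D {l} l-true l∈ with ∈-++⁻ C′ l∈
  ... | inj₁ l∈C′ = contradiction (trans (sym l-true) (fals (proj₂ C≐ (there l∈C′)))) λ ()
  ... | inj₂ l∈D′ with ∈-filter⁻ (λ l → ¬? (l ≟ˡ complement p)) l∈D′
  ...   | l∈D , l≢p̄ = l , l∈D , l≢p̄ , l-true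

  -- Of the two clashing literals, the one that `θ` makes true cannot lie in the falsified `C′`, so
  -- it comes from `D`.
  true-literal : ∀ b → θ v ≡ b → ∃ λ l → l ∈ lits D × l ≢ complement p × value θ l ≡ true
  true-literal true  eq = in-D {pos v} eq v∈
  true-literal false eq = in-D {neg v} (cong not eq) v̄∈

-- Kernels and blocked extensions

blocked-resp-≐ : ∀ {Γ} C D → lits C ≐ lits D → Blocked C Γ → Blocked D Γ
blocked-resp-≐ C D C≐D (p , C′ , p∉ , C≐ , b) = p , C′ , p∉ , ≐-trans (≐-sym C≐D) C≐ , b

blocked-antitone : ∀ {Γ Δ} C → Γ ⊆ᶜ Δ → Blocked C Δ → Blocked C Γ
blocked-antitone C Γ⊆Δ (p , C′ , p∉ , C≐ , b) = p , C′ , p∉ , C≐ , λ D D∈ → b D (Γ⊆Δ {D} D∈)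

removal-keeps : ∀ {Γ} C D → D ∈ᶜ Γ → ¬ (lits C ≐ lits D) → D ∈ᶜ (Γ - C)
removal-keeps {Γ} C D D∈Γ C≠D with find D∈Γ
... | D₀ , D₀∈Γ , D≐D₀ =
  lose (∈-filter⁺ (λ D → ¬? (C ≟ᶜ D)) D₀∈Γ λ C≐D₀ → C≠D (≐-trans C≐D₀ (≐-sym D≐D₀))) D≐D₀

removal-shrinks : ∀ {Γ} C D → D ∈ᶜ (Γ - C) → D ∈ᶜ Γ
removal-shrinks {Γ} C D D∈ with find D∈
... | D₀ , D₀∈ , D≐D₀ = lose (proj₁ (∈-filter⁻ (λ D → ¬? (C ≟ᶜ D)) {xs = Γ} D₀∈)) D≐D₀

reduct-⊆ : ∀ {Γ K} → Star _⟶_ Γ K → ∀ D → D ∈ᶜ K → D ∈ᶜ Γ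
reduct-⊆ ε                      D D∈ = D∈
reduct-⊆ (remove {C} _ _ ◅ red) D D∈ = removal-shrinks C D (reduct-⊆ red D D∈)

Unblocked : CNF → Set
Unblocked Γ = ∀ C → C ∈ᶜ Γ → ¬ Blocked C Γ

-- Fewer clauses make blocking easier, so a clause blocked in the larger `Δ` is blocked in `Γ`.
-- Since no clause of `Γ` is blocked there, `Γ` survives every removal and the inclusion persists.
removed-blocked : ∀ {Γ Δ K} → Unblocked Γ → Γ ⊆ᶜ Δ → Star _⟶_ Δ K →
                  ∀ C → C ∈ᶜ Δ → C ∈ᶜ K ⊎ Blocked C Γ
removed-blocked unblocked Γ⊆Δ ε C C∈ = inj₁ C∈
removed-blocked {Γ} {Δ} unblocked Γ⊆Δ (remove {B} _ B-blocked ◅ red) C C∈ with B ≟ᶜ C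
... | yes B≐C = inj₂ (blocked-resp-≐ B C B≐C (blocked-antitone B (λ {D} → Γ⊆Δ {D}) B-blocked))
... | no  B≠C = removed-blocked unblocked (λ {D} → Γ⊆Δ-B {D}) red C (removal-keeps B C C∈ B≠C)
  where
  Γ⊆Δ-B : Γ ⊆ᶜ (Δ - B)
  Γ⊆Δ-B {D} D∈ = removal-keeps B D (Γ⊆Δ {D} D∈) λ B≐D →
    unblocked D D∈ (blocked-resp-≐ B D B≐D (blocked-antitone B (λ {D} → Γ⊆Δ {D}) B-blocked))

-- A clause that survives the removal lies in the common kernel, hence in `Γ`.
extension-blocked : ∀ {Γ Λ} → Unblocked Γ → BlockedExtension Γ Λ →
                    ∀ C → C ∈ᶜ (Γ ++ Λ) → C ∈ᶜ Γ ⊎ Blocked C Γ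
extension-blocked unblocked (K , K′ , (red , _) , (red′ , _) , (K⊆K′ , _)) C C∈ =
  Sum.map₁ (λ C∈K → reduct-⊆ red′ C (K⊆K′ {C} C∈K))
           (removed-blocked unblocked Any.++⁺ˡ red C C∈)

-- Refutations evaluated at critical assignments

module CriticalAssignments (m : ℕ) {{_ : NonZero m}} where

  private instance
    cells≢0 : NonZero (suc m * m)
    cells≢0 = m*n≢0 (suc m) m

  cell : Var → Fin (suc m) × Fin m
  cell v = remQuot m (v mod (suc m * m))

  -- Every variable is read as some x r j, so an assignment of pigeons to holes
  -- also evaluates the foreign variables introduced by weakening.
  pigeonOf : Var → Fin (suc m)
  pigeonOf = proj₁ ∘ cell

  holeOf : Var → Fin m
  holeOf = proj₂ ∘ cell

  cell-x : ∀ r j → cell (x r j) ≡ (r , j)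
  cell-x r j = trans (cong (remQuot m) (toℕ-injective
    (trans (toℕ-fromℕ< _) (m<n⇒m%n≡m (toℕ<n (combine r j)))))) (remQuot-combine r j)

  pigeonOf-x : ∀ r j → pigeonOf (x r j) ≡ r
  pigeonOf-x r j = cong proj₁ (cell-x r j)

  holeOf-x : ∀ r j → holeOf (x r j) ≡ j
  holeOf-x r j = cong proj₂ (cell-x r j)

  ⟦_⟧ : Critical m → Var → Bool
  ⟦ π ⟧ v = does (π ⟨$⟩ʳ suc (holeOf v) Fin.≟ pigeonOf v)

  ⟦⟧-x : ∀ π r j → ⟦ π ⟧ (x r j) ≡ does (π ⟨$⟩ʳ suc j Fin.≟ r)
  ⟦⟧-x π r j = cong₂ (λ i k → does (π ⟨$⟩ʳ suc k Fin.≟ i)) (pigeonOf-x r j) (holeOf-x r j)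

  ⟦⟧-true⁻ : ∀ π {r j} → ⟦ π ⟧ (x r j) ≡ true → π ⟨$⟩ʳ suc j ≡ r
  ⟦⟧-true⁻ π {r} {j} eq with π ⟨$⟩ʳ suc j Fin.≟ r | ⟦⟧-x π r j
  ... | yes occupied | _   = occupied
  ... | no _         | eq′ = contradiction (trans (sym eq) eq′) λ ()

  ⟦⟧-true⁺ : ∀ π {r j} → π ⟨$⟩ʳ suc j ≡ r → ⟦ π ⟧ (x r j) ≡ true
  ⟦⟧-true⁺ π {r} {j} occupied = trans (⟦⟧-x π r j) (dec-true (π ⟨$⟩ʳ suc j Fin.≟ r) occupied)

  not-false : ∀ {b} → not b ≡ false → b ≡ true
  not-false {true} _ = refl

  not-true : ∀ {b} → not b ≡ true → b ≡ false
  not-true {false} _ = refl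

  -- Critical assignments are rigid: any flip of a variable falsifies a clause
  -- that was satisfied by this variable alone.
  blocked-satisfied : ∀ {C p} {r : Fin (suc m)} {j} → var p ≡ x r j → BlockedFor p C (php m) →
                      ∀ π → ¬ Falsified ⟦ π ⟧ (lits C)
  -- Hole `j` holds another pigeon; adding `r` falsifies the hole clause of the two.
  blocked-satisfied {C} {pos _} {r} {j} refl blocked@(_ , _ , C≐ , _) π fals
    with has-clause (php-hole j r≢s)
    where
    r≢s : r ≢ π ⟨$⟩ʳ suc j
    r≢s r≡ = contradiction (trans (sym (fals (proj₂ C≐ (here refl)))) (⟦⟧-true⁺ π (sym r≡))) λ ()
  ... | D , D∈ , D≐ with blocked-witness {C = C} blocked fals D D∈ (proj₁ D≐ (here refl))
  ...   | l , l∈ , l≢ , l-true with proj₂ D≐ l∈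
  ...     | here refl         = l≢ refl
  ...     | there (here refl) = contradiction (trans (sym (⟦⟧-true⁺ π refl)) (not-true l-true)) λ ()
  -- Pigeon `r` sits in hole `j` and nowhere else; taking it out falsifies its pigeon clause.
  blocked-satisfied {C} {neg _} {r} {j} refl blocked@(_ , _ , C≐ , _) π fals
    with has-clause (php-pigeon r)
  ... | D , D∈ , D≐ with blocked-witness {C = C} blocked fals D D∈ (proj₁ D≐ (∈-pigeonLits⁺ r j))
  ...   | l , l∈ , l≢ , l-true with ∈-pigeonLits⁻ r (proj₂ D≐ l∈)
  ...     | k , refl = l≢ (cong (λ j → pos (x r j)) (Fin.suc-injective (begin
    suc k                                  ≡⟨ inverseˡ π ⟨
    π ⟨$⟩ˡ (π ⟨$⟩ʳ suc k)                  ≡⟨ cong (π ⟨$⟩ˡ_) (trans (⟦⟧-true⁻ π l-true) (sym r-in-j)) ⟩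
    π ⟨$⟩ˡ (π ⟨$⟩ʳ suc j)                  ≡⟨ inverseˡ π ⟩
    suc j                                  ∎)))
    where
    open ≡-Reasoning
    r-in-j : π ⟨$⟩ʳ suc j ≡ r
    r-in-j = ⟦⟧-true⁻ π (not-false (fals (proj₂ C≐ (here refl))))

  falsified-pigeon : ∀ π r → Falsified ⟦ π ⟧ (pigeonLits r) → π ⟨$⟩ʳ zero ≡ r
  falsified-pigeon π r fals with π ⟨$⟩ˡ r in eq
  ... | zero  = trans (cong (π ⟨$⟩ʳ_) (sym eq)) (inverseʳ π)
  ... | suc j = contradiction
    (trans (sym (fals (∈-pigeonLits⁺ r j))) (⟦⟧-true⁺ π (trans (cong (π ⟨$⟩ʳ_) (sym eq)) (inverseʳ π)))) λ ()

  omitted-falsified : ∀ π → Falsified ⟦ π ⟧ (pigeonLits (π ⟨$⟩ʳ zero))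
  omitted-falsified π l∈ with ∈-pigeonLits⁻ (π ⟨$⟩ʳ zero) l∈
  ... | j , refl = trans (⟦⟧-x π (π ⟨$⟩ʳ zero) j) (dec-false (_ Fin.≟ _) λ eq →
    contradiction (trans (sym (inverseˡ π)) (trans (cong (π ⟨$⟩ˡ_) eq) (inverseˡ π))) λ ())

  -- A pigeon clause is falsified by a critical assignment omitting its pigeon, contrary to
  -- `blocked-satisfied`. No critical assignment falsifies a hole clause, so that case takes a
  -- different assignment.
  php-unblocked : Unblocked (php m)
  php-unblocked C C∈ (p , blocked@(_ , _ , C≐ , _)) with php-shape C∈
  ... | pigeon r C≐r with shape-vars (pigeon r C≐r) (proj₂ C≐ (here refl))
  ...   | s , j , p≡ = blocked-satisfied {C} {p} {s} {j} p≡ blocked (transpose zero r)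
                         λ l∈ → omitted-falsified (transpose zero r) (proj₁ C≐r l∈)
  php-unblocked C C∈ (p , blocked@(_ , _ , C≐ , _)) | hole r s j r≢s C≐rs =
    p-negative (p-shape (proj₁ C≐rs (proj₂ C≐ (here refl))))
    where
    -- Every pigeon sits in hole `j` and only there; flipping a variable of that hole leaves its
    -- pigeon without a hole.
    θ : Var → Bool
    θ v = does (holeOf v Fin.≟ j)

    θ-x : ∀ q → θ (x q j) ≡ true
    θ-x q = dec-true (_ Fin.≟ j) (holeOf-x q j)

    fals : Falsified θ (lits C)
    fals l∈ with proj₁ C≐rs l∈
    ... | here refl         = cong not (θ-x r)
    ... | there (here refl) = cong not (θ-x s)

    p-shape : p ∈ holeLits r s j → ∃ λ q → p ≡ neg (x q j)
    p-shape (here refl)         = r , refl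
    p-shape (there (here refl)) = s , refl

    p-negative : ¬ (∃ λ q → p ≡ neg (x q j))
    p-negative (q , refl) with has-clause (php-pigeon q)
    ... | D , D∈ , D≐ with blocked-witness {C = C} blocked fals D D∈ (proj₁ D≐ (∈-pigeonLits⁺ q j))
    ...   | l , l∈ , l≢ , l-true with ∈-pigeonLits⁻ q (proj₂ D≐ l∈)
    ...     | k , refl with holeOf (x q k) Fin.≟ j | l-true
    ...       | yes eq | _ = l≢ (cong (λ k → pos (x q k)) (trans (sym (holeOf-x q k)) eq))

  -- A critical assignment puts exactly one pigeon in every hole, so a negated variable is replaced
  -- by all edges that put another pigeon in the same hole.
  monotone : Clause → MClause m
  monotone C = just λ j i →
    any (λ l → does (holeOf (var l) Fin.≟ j) ∧ value (λ v → does (i Fin.≟ pigeonOf v)) l) (lits C)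

  value-π : ∀ π l → value ⟦ π ⟧ l ≡ value (λ v → does (π ⟨$⟩ʳ suc (holeOf (var l)) Fin.≟ pigeonOf v)) l
  value-π π (pos v) = refl
  value-π π (neg v) = refl

  monotone-falsified⁺ : ∀ C π → Falsified ⟦ π ⟧ (lits C) → Falsifies π (monotone C)
  monotone-falsified⁺ C π fals j = any-false (lits C) fals
    where
    any-false : ∀ S → Falsified ⟦ π ⟧ S →
      any (λ l → does (holeOf (var l) Fin.≟ j) ∧ value (λ v → does (π ⟨$⟩ʳ suc j Fin.≟ pigeonOf v)) l) S ≡ false
    any-false []      _    = refl
    any-false (l ∷ S) fals with holeOf (var l) Fin.≟ j
    ... | no _     = any-false S (fals ∘ there)
    ... | yes refl rewrite trans (sym (value-π π l)) (fals (here refl)) = any-false S (fals ∘ there)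

  monotone-falsified⁻ : ∀ C π → Falsifies π (monotone C) → Falsified ⟦ π ⟧ (lits C)
  monotone-falsified⁻ C π fals {l} l∈ = trans (value-π π l) (all-false (lits C) (fals j) l∈)
    where
    j = holeOf (var l)
    p : Literal → Bool
    p l = does (holeOf (var l) Fin.≟ j) ∧ value (λ v → does (π ⟨$⟩ʳ suc j Fin.≟ pigeonOf v)) l

    all-false : ∀ S → any p S ≡ false → l ∈ S → value (λ v → does (π ⟨$⟩ʳ suc j Fin.≟ pigeonOf v)) l ≡ false
    all-false (k ∷ S) eq (here refl) rewrite dec-true (holeOf (var l) Fin.≟ j) refl
      with value (λ v → does (π ⟨$⟩ʳ suc j Fin.≟ pigeonOf v)) l | eq
    ... | false | _ = refl
    all-false (k ∷ S) eq (there l∈) with p k | eq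
    ... | false | eq′ = all-false S eq′ l∈

  php-axiom : ∀ C → C ∈ᶜ php m → Axiom (monotone C)
  php-axiom C C∈ π ρ π-fals ρ-fals with php-shape C∈
  ... | pigeon r C≐ = trans
    (falsified-pigeon π r λ l∈ → monotone-falsified⁻ C π π-fals (proj₂ C≐ l∈))
    (sym (falsified-pigeon ρ r λ l∈ → monotone-falsified⁻ C ρ ρ-fals (proj₂ C≐ l∈)))
  ... | hole r s j r≢s C≐ = contradiction
    (trans (sym (occupied (here refl))) (occupied (there (here refl)))) r≢s
    where
    occupied : ∀ {q} → neg (x q j) ∈ holeLits r s j → π ⟨$⟩ʳ suc j ≡ q
    occupied l∈ = ⟦⟧-true⁻ π (not-false (monotone-falsified⁻ C π π-fals (proj₂ C≐ l∈)))

  -- A clause outside the formula is blocked with respect to it, and as no new variables occur, the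
  -- blocking literal is on some `x r j`. Such a clause is never falsified, so it is an axiom
  -- vacuously.
  extension-axiom : ∀ {Λ} → BlockedExtension (php m) Λ → vars Λ ⊆ vars (php m) →
                    ∀ C → C ∈ᶜ (php m ++ Λ) → Axiom (monotone C)
  extension-axiom {Λ} ext Λ-vars C C∈ with extension-blocked php-unblocked ext C C∈
  ... | inj₁ C∈php = php-axiom C C∈php
  ... | inj₂ (p , blocked@(_ , _ , C≐ , _)) with clause-var C∈ (proj₂ C≐ (here refl))
    where
    clause-var : ∀ {l} → C ∈ᶜ (php m ++ Λ) → l ∈ lits C → ∃₂ λ r j → var l ≡ x {m} r j
    clause-var C∈ l∈ with find C∈
    ... | D , D∈ , C≐D with ∈-++⁻ (php m) D∈
    ...   | inj₁ D∈php = php-vars⁻ (vars⁺ D∈php (∈-map⁺ var (proj₁ C≐D l∈)))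
    ...   | inj₂ D∈Λ   = php-vars⁻ (Λ-vars (vars⁺ D∈Λ (∈-map⁺ var (proj₁ C≐D l∈))))
  ...   | r , j , p≡ = λ π _ π-fals _ →
    contradiction (λ {l} → monotone-falsified⁻ C π π-fals {l}) (blocked-satisfied {C} {p} {r} {j} p≡ blocked π)

  resolvent-falsified : ∀ {C D E} θ → Resolvent C D E → Falsified θ (lits E) →
                        Falsified θ (lits C) ⊎ Falsified θ (lits D)
  resolvent-falsified {C} {D} θ (v , A , B , _ , _ , C≐ , D≐ , E≐) fals with θ v in eq
  ... | false = inj₁ λ l∈ → left (proj₁ C≐ l∈)
    where
    left : ∀ {l} → l ∈ pos v ∷ A → value θ l ≡ false
    left (here refl) = eq
    left (there l∈)  = fals (proj₂ E≐ (∈-++⁺ˡ l∈))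
  ... | true  = inj₂ λ l∈ → right (proj₁ D≐ l∈)
    where
    right : ∀ {l} → l ∈ neg v ∷ B → value θ l ≡ false
    right (here refl) = cong not eq
    right (there l∈)  = fals (proj₂ E≐ (∈-++⁺ʳ A l∈))

  Covered : List (MClause m) → CNF → Set
  Covered cs Δ = ∀ C → C ∈ᶜ Δ →
    ∃ λ a → Premise cs a × (∀ π → Falsified ⟦ π ⟧ (lits C) → Falsifies π a)

  covered-step : ∀ {cs Δ} E → Covered cs Δ → Covered (monotone E ∷ cs) (E ∷ Δ)
  covered-step E cov C (here C≐E) =
    monotone E , inj₂ (here refl) , λ π fals → monotone-falsified⁺ E π λ l∈ → fals (proj₂ C≐E l∈)
  covered-step E cov C (there C∈) with cov C C∈
  ... | a , a∈ , fals = a , Sum.map₂ there a∈ , fals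

  resolution-derivation : ∀ {Δ N cs} → ResolutionProof Δ N → Derivation cs → Covered cs Δ →
    ∃₂ λ (cs′ : List (MClause m)) a → Derivation cs′ × Premise cs′ a × (∀ π → Falsifies π a) × length cs′ ≤ N + length cs
  resolution-derivation {cs = cs} (done ⊥∈) d cov with cov ⊥ᶜ ⊥∈
  ... | a , a∈ , fals = cs , a , d , a∈ , (λ π → fals π λ ()) , m≤n+m _ 1
  resolution-derivation {N = suc N} {cs} (add E rule proof) d cov
    with resolution-derivation proof (extend-by rule) (covered-step E cov)
    where
    extend-by : ResolutionRule _ E → Derivation (monotone E ∷ cs)
    extend-by (weaken {C} C∈ C⊆E) with cov C C∈
    ... | a , a∈ , fals = step (monotone E) a∈ a∈
      (λ π E-fals → inj₁ (fals π λ l∈ → monotone-falsified⁻ E π E-fals (C⊆E l∈))) d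
    extend-by (resolve {C} {D} C∈ D∈ res) with cov C C∈ | cov D D∈
    ... | a , a∈ , a-fals | b , b∈ , b-fals = step (monotone E) a∈ b∈
      (λ π E-fals → Sum.map (a-fals π) (b-fals π)
        (resolvent-falsified {C} {D} {E} ⟦ π ⟧ res (monotone-falsified⁻ E π E-fals))) d
  ... | cs′ , a , d′ , a∈ , fals , le =
    cs′ , a , d′ , a∈ , fals , ≤-trans le (≤-reflexive (+-suc N (length cs)))

-- All clauses of `Λ` enter as axioms, so the resolution part alone is already long, however large
-- the extension is.
ger-lower-bound : ∀ n → 1 ≤ n → (π : GER⁻Proof (php (4 * n))) → 2 ^ n ≤ GER⁻Proof.size π ^ 14
ger-lower-bound n@(suc _) 1≤n π
  with CriticalAssignments.resolution-derivation (4 * n) Π [] (λ C C∈ →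
         monotone C , inj₁ (extension-axiom blockedExtension noNewVars C C∈) ,
         λ ρ → monotone-falsified⁺ C ρ)
  where
  open GER⁻Proof π
  open CriticalAssignments (4 * n)
... | cs , a , d , a∈ , fals , le = ≤-trans (refutation-length n 1≤n d a∈ fals)
  (^-monoˡ-≤ 14 (≤-trans le (≤-trans (≤-reflexive (+-identityʳ N)) (m≤n+m N ∣ Λ ∣))))
  where open GER⁻Proof π

-- Set-blocked refutations of the pigeonhole principle

module Extensions (V : List Var) where

  data Extends (Γ : CNF) : ℕ → CNF → Set where
    stop : Extends Γ 0 Γ
    step : ∀ {N Δ} E → SBCRule Γ E → litVars (lits E) ⊆ V → Extends (E ∷ Γ) N Δ → Extends Γ (suc N) Δ

  extends-trans : ∀ {Γ Δ Θ M N} → Extends Γ M Δ → Extends Δ N Θ → Extends Γ (M + N) Θ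
  extends-trans stop            δ = δ
  extends-trans (step E r v γ) δ = step E r v (extends-trans γ δ)

  extends-has : ∀ {Γ Δ N S} → Extends Γ N Δ → Has Γ S → Has Δ S
  extends-has stop           h = h
  extends-has (step E r v γ) h = extends-has γ (there h)

  extends-proof : ∀ {Γ Δ N} → vars Γ ⊆ V → Extends Γ N Δ → Has Δ [] →
    ∃ λ (π : SBCProof Γ (suc N)) → Vec.All (λ Θ → vars Θ ⊆ V) (sequence π)
  extends-proof Γ⊆V stop           h = done h , (λ {v} → Γ⊆V {v}) Vec.∷ Vec.[]
  extends-proof {Γ} Γ⊆V (step E r v γ) h with extends-proof (λ {v} → EΓ⊆V {v}) γ h
    where
    EΓ⊆V : vars (E ∷ Γ) ⊆ V
    EΓ⊆V u∈ = [ v , Γ⊆V ]′ (∈-++⁻ (litVars (lits E)) u∈)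
  ... | π , all = add E r π , (λ {v} → Γ⊆V {v}) Vec.∷ all

  Reach : CNF → ℕ → (CNF → Set) → Set
  Reach Γ b Q = ∃₂ λ N Δ → N ≤ b × Extends Γ N Δ × Q Δ

  reach-here : ∀ {Γ b Q} → Q Γ → Reach Γ b Q
  reach-here {Γ} q = 0 , Γ , z≤n , stop , q

  reach-≤ : ∀ {Γ a b Q} → a ≤ b → Reach Γ a Q → Reach Γ b Q
  reach-≤ a≤b (N , Δ , le , γ , q) = N , Δ , ≤-trans le a≤b , γ , q

  reach-bind : ∀ {Γ a b P Q} → Reach Γ a P →
    (∀ {N Δ} → Extends Γ N Δ → P Δ → Reach Δ b Q) → Reach Γ (a + b) Q
  reach-bind (M , Δ , M≤a , γ , p) f with f γ p
  ... | N , Θ , N≤b , δ , q = M + N , Θ , +-mono-≤ M≤a N≤b , extends-trans γ δ , q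

  reach-map : ∀ {Γ b P Q} → (∀ {Δ} → P Δ → Q Δ) → Reach Γ b P → Reach Γ b Q
  reach-map f (N , Δ , le , γ , p) = N , Δ , le , γ , f p

  reach-extends : ∀ {Γ b P Q} → Reach Γ b P →
    (∀ {N Δ} → Extends Γ N Δ → P Δ → Q Δ) → Reach Γ b Q
  reach-extends (N , Δ , le , γ , p) f = N , Δ , le , γ , f γ p

  Stable : (CNF → Set) → Set
  Stable Q = ∀ {N Γ Δ} → Extends Γ N Δ → Q Γ → Q Δ

  -- Stability lets what is achieved for one element survive the additions made for the others.
  reach-each : ∀ {A : Set} {b} {Q : A → CNF → Set} {Γ} xs → (∀ a → Stable (Q a)) →
    (∀ a {N Δ} → Extends Γ N Δ → Reach Δ b (Q a)) →
    Reach Γ (length xs * b) (λ Δ → ∀ {a} → a ∈ xs → Q a Δ)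
  reach-each []       stable f = reach-here λ ()
  reach-each (a ∷ xs) stable f = reach-bind (f a stop) λ γ q →
    reach-extends (reach-each xs stable λ b δ → f b (extends-trans γ δ)) λ δ qs →
      λ { (here refl) → stable a δ q ; (there b∈) → qs b∈ }

  add-clause : ∀ {Γ} E → SBCRule Γ E → litVars (lits E) ⊆ V → Reach Γ 1 (λ Δ → Has Δ (lits E))
  add-clause {Γ} E r v = 1 , E ∷ Γ , ≤-refl , step E r v stop , here ≐-refl

  -- Elimination of positive literals by resolution

  ++-pos : LitSet → List Var → LitSet
  ++-pos T us = T ++ map pos us

  private
    drop-var : ∀ T u us → ++-pos T us ⊆ ++-pos T (u ∷ us)
    drop-var T u us l∈ = [ ∈-++⁺ˡ , ∈-++⁺ʳ T ∘ there ]′ (∈-++⁻ T l∈)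

    split-var : ∀ T u us {l} → l ∈ ++-pos T (u ∷ us) → l ≡ pos u ⊎ l ∈ ++-pos T us
    split-var T u us l∈ with ∈-++⁻ T l∈
    ... | inj₁ l∈T          = inj₂ (∈-++⁺ˡ l∈T)
    ... | inj₂ (here refl)  = inj₁ refl
    ... | inj₂ (there l∈us) = inj₂ (∈-++⁺ʳ T l∈us)

    head-var : ∀ T u us → pos u ∈ ++-pos T (u ∷ us)
    head-var T u us = ∈-++⁺ʳ T (here refl)

  Cuts : CNF → LitSet → List Var → Set
  Cuts Γ T us = ∀ {u} → u ∈ us → ∃ λ B → B ⊆ T × Has Γ (neg u ∷ B)

  -- Each cut clause removes one positive literal and contributes only literals already in `T`.
  eliminate-exact : ∀ {Γ} T us → litVars (++-pos T us) ⊆ V → ¬ Tautological (++-pos T us) →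
    Has Γ (++-pos T us) → Cuts Γ T us → Reach Γ (length us) (λ Δ → Has Δ T)
  eliminate-exact T [] vs nt h cuts = reach-here (has-resp-≐
    ((λ l∈ → [ id , (λ ()) ]′ (∈-++⁻ T l∈)) , ∈-++⁺ˡ) h)
  eliminate-exact {Γ} T (u ∷ us) vs nt h cuts with pos u ∈? ++-pos T us
  -- A repeated variable is dropped without resolving, since a pivot may not remain in the
  -- resolvent.
  ... | yes u∈ = reach-≤ (n≤1+n _) (eliminate-exact T us vs′ nt′ (has-resp-≐ same h) (cuts ∘ there))
    where
    vs′ : litVars (++-pos T us) ⊆ V
    vs′ v∈ with ∈-map⁻ var v∈
    ... | l , l∈ , refl = vs (∈-map⁺ var (drop-var T u us l∈))
    nt′ : ¬ Tautological (++-pos T us)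
    nt′ (v , p , n) = nt (v , drop-var T u us p , drop-var T u us n)
    same : ++-pos T (u ∷ us) ≐ ++-pos T us
    same = (λ l∈ → [ (λ { refl → u∈ }) , id ]′ (split-var T u us l∈)) , drop-var T u us
  ... | no u∉ with cuts (here refl)
  ...   | B , B⊆T , h′ with has-clause h | has-clause h′
  ...     | C , C∈ , C≐ | D , D∈ , D≐ =
    reach-bind (add-clause E (resolution (resolve {C = C} {D} C∈ D∈ resolvent)) vs′) λ γ hE →
      eliminate-exact T us vs′ nt′ hE λ u∈ → let B , B⊆T , h = cuts (there u∈) in B , B⊆T , extends-has γ h
    where
    vs′ : litVars (++-pos T us) ⊆ V
    vs′ v∈ with ∈-map⁻ var v∈
    ... | l , l∈ , refl = vs (∈-map⁺ var (drop-var T u us l∈))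
    nt′ : ¬ Tautological (++-pos T us)
    nt′ (v , p , n) = nt (v , drop-var T u us p , drop-var T u us n)
    E : Clause
    E = clause (++-pos T us) nt′
    u-fresh : u ∉ litVars (++-pos T us)
    u-fresh u∈ with ∈-map⁻ var u∈
    ... | pos _ , l∈ , refl = u∉ l∈
    ... | neg _ , l∈ , refl = nt (u , head-var T u us , drop-var T u us l∈)
    B⊆E : B ⊆ ++-pos T us
    B⊆E = ∈-++⁺ˡ ∘ B⊆T
    resolvent : Resolvent C D E
    resolvent = u , ++-pos T us , B , u-fresh ,
      (λ u∈ → let l , l∈ , eq = ∈-map⁻ var u∈ in u-fresh (subst (_∈ _) (sym eq) (∈-map⁺ var (B⊆E l∈)))) ,
      ≐-trans (≐-sym C≐)
        ((λ l∈ → [ (λ { refl → here refl }) , there ]′ (split-var T u us l∈)) ,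
         (λ { (here refl) → head-var T u us ; (there l∈) → drop-var T u us l∈ })) ,
      ≐-sym D≐ ,
      (∈-++⁺ˡ , λ l∈ → [ id , B⊆E ]′ (∈-++⁻ (++-pos T us) l∈))

  -- One initial weakening pads the clause to the exact form, which accounts for the extra addition.
  eliminate : ∀ {Γ} S T us → litVars (++-pos T us) ⊆ V → ¬ Tautological (++-pos T us) →
    Has Γ S → S ⊆ ++-pos T us → Cuts Γ T us → Reach Γ (suc (length us)) (λ Δ → Has Δ T)
  eliminate S T us vs nt h S⊆ cuts with has-clause h
  ... | C , C∈ , S≐C =
    reach-bind (add-clause (clause (++-pos T us) nt)
                 (resolution (weaken {C = C} C∈ (S⊆ ∘ proj₂ S≐C))) vs) λ γ hE →
      eliminate-exact T us vs nt hE λ u∈ → let B , B⊆T , h = cuts u∈ in B , B⊆T , extends-has γ h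

-- Set-blocked swap clauses

module _ {m : ℕ} where

  crossLits : (p : Fin (suc m)) (h : Fin m) (i : Fin (suc m)) (j : Fin m) → LitSet
  crossLits p h i j = neg (x p j) ∷ neg (x i h) ∷ []

  others : Fin (suc m) → Fin m → List Var
  others p j = map (λ s → x (punchIn p s) j) (allFin m)

  ∈-others⁻ : ∀ p j {v} → v ∈ others p j → ∃ λ r → r ≢ p × v ≡ x r j
  ∈-others⁻ p j v∈ with ∈-map⁻ _ v∈
  ... | s , _ , refl = punchIn p s , punchInᵢ≢i p s , refl

  ∈-others⁺ : ∀ {p r} j → r ≢ p → x r j ∈ others p j
  ∈-others⁺ {p} {r} j r≢p = subst (λ r → x r j ∈ others p j) (punchIn-punchOut (r≢p ∘ sym))
    (∈-map⁺ (λ s → x (punchIn p s) j) (∈-allFin (punchOut (r≢p ∘ sym))))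

  swapVars : (p : Fin (suc m)) (h : Fin m) (i : Fin (suc m)) (j : Fin m) → List Var
  swapVars p h i j = others p j ++ others i h

  -- Falsified exactly when pigeon p sits alone in hole j and pigeon i alone in
  -- hole h; flipping swapLits₀ then exchanges the two pigeons.
  swapLits swapLits₀ : (p : Fin (suc m)) (h : Fin m) (i : Fin (suc m)) (j : Fin m) → LitSet
  swapLits  p h i j = crossLits p h i j ++ map pos (swapVars p h i j)
  swapLits₀ p h i j = crossLits p h i j ++ pos (x i j) ∷ pos (x p h) ∷ []

  data InSwap (p : Fin (suc m)) (h : Fin m) (i : Fin (suc m)) (j : Fin m) : Literal → Set where
    cross-p  : InSwap p h i j (neg (x p j))
    cross-i  : InSwap p h i j (neg (x i h))
    column-j : ∀ r → r ≢ p → InSwap p h i j (pos (x r j))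
    column-h : ∀ r → r ≢ i → InSwap p h i j (pos (x r h))

  in-swap⁻ : ∀ p h i j {l} → l ∈ swapLits p h i j → InSwap p h i j l
  in-swap⁻ p h i j (here refl)         = cross-p
  in-swap⁻ p h i j (there (here refl)) = cross-i
  in-swap⁻ p h i j (there (there l∈)) with ∈-map⁻ pos l∈
  ... | v , v∈ , refl with ∈-++⁻ (others p j) v∈
  ...   | inj₁ v∈j with ∈-others⁻ p j v∈j
  ...     | r , r≢p , refl = column-j r r≢p
  in-swap⁻ p h i j (there (there l∈)) | v , v∈ , refl | inj₂ v∈h with ∈-others⁻ i h v∈h
  ...     | r , r≢i , refl = column-h r r≢i

  in-swap⁺ : ∀ p h i j {l} → InSwap p h i j l → l ∈ swapLits p h i j
  in-swap⁺ p h i j cross-p = here refl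
  in-swap⁺ p h i j cross-i = there (here refl)
  in-swap⁺ p h i j (column-j r r≢p) = there (there (∈-map⁺ pos (∈-++⁺ˡ (∈-others⁺ j r≢p))))
  in-swap⁺ p h i j (column-h r r≢i) =
    there (there (∈-map⁺ pos (∈-++⁺ʳ (others p j) (∈-others⁺ h r≢i))))

  in-swap-clash : ∀ {p h i j v} → h ≢ j → InSwap p h i j (pos v) → InSwap p h i j (neg v) → ⊥
  in-swap-clash {p} {h} {i} {j} h≢j P N = go P N refl refl
    where
    go : ∀ {k l} → InSwap p h i j k → InSwap p h i j l → ∀ {v} → k ≡ pos v → l ≡ neg v → ⊥
    go (column-j r r≢p) cross-p refl eq = r≢p (sym (proj₁ (x-injective p j r j (neg-injective eq))))
    go (column-j r r≢p) cross-i refl eq = h≢j (proj₂ (x-injective i h r j (neg-injective eq)))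
    go (column-h r r≢i) cross-p refl eq = h≢j (sym (proj₂ (x-injective p j r h (neg-injective eq))))
    go (column-h r r≢i) cross-i refl eq = r≢i (sym (proj₁ (x-injective i h r h (neg-injective eq))))

  swap-consistent : ∀ p {h} i {j} → h ≢ j → ¬ Tautological (swapLits p h i j)
  swap-consistent p i h≢j (v , v∈ , v̄∈) =
    in-swap-clash h≢j (in-swap⁻ p _ i _ v∈) (in-swap⁻ p _ i _ v̄∈)

  InCells : LitSet → Set
  InCells S = ∀ {l} → l ∈ S → ∃₂ λ r j → var l ≡ x {m} r j

  cells-vars : ∀ {S} → InCells S → litVars S ⊆ vars (php m)
  cells-vars cells v∈ with ∈-map⁻ var v∈
  ... | l , l∈ , refl with cells l∈
  ...   | r , j , eq = subst (_∈ vars (php m)) (sym eq) (php-vars⁺ r j)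

  swap-cells : ∀ p h i j → InCells (swapLits p h i j)
  swap-cells p h i j l∈ with in-swap⁻ p h i j l∈
  ... | cross-p      = p , j , refl
  ... | cross-i      = i , h , refl
  ... | column-j r _ = r , j , refl
  ... | column-h r _ = r , h , refl

  module _ {p : Fin (suc m)} {h : Fin m} {i : Fin (suc m)} {j : Fin m} (i≢p : i ≢ p) (h≢j : h ≢ j) where

    private
      C L : LitSet
      C = swapLits p h i j
      L = swapLits₀ p h i j

      touched : ∀ {l} → l ∈ complements L →
                l ≡ pos (x p j) ⊎ l ≡ pos (x i h) ⊎ l ≡ neg (x i j) ⊎ l ≡ neg (x p h)
      touched (here eq)                         = inj₁ eq
      touched (there (here eq))                 = inj₂ (inj₁ eq)
      touched (there (there (here eq)))         = inj₂ (inj₂ (inj₁ eq))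
      touched (there (there (there (here eq)))) = inj₂ (inj₂ (inj₂ eq))

      ij∈L : pos (x i j) ∈ L
      ij∈L = there (there (here refl))

      ph∈L : pos (x p h) ∈ L
      ph∈L = there (there (there (here refl)))

      pos∉L : ∀ {r k} → ¬ (r ≡ i × k ≡ j) → ¬ (r ≡ p × k ≡ h) → pos (x r k) ∉ L
      pos∉L {r} {k} ≢ij ≢ph (there (there (here eq)))         = ≢ij (x-injective r k i j (pos-injective eq))
      pos∉L {r} {k} ≢ij ≢ph (there (there (there (here eq)))) = ≢ph (x-injective r k p h (pos-injective eq))

      neg∉L̄ : ∀ {r k} → ¬ (r ≡ i × k ≡ j) → ¬ (r ≡ p × k ≡ h) → neg (x r k) ∉ complements L
      neg∉L̄ {r} {k} ≢ij ≢ph (there (there (here eq)))         = ≢ij (x-injective r k i j (neg-injective eq))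
      neg∉L̄ {r} {k} ≢ij ≢ph (there (there (there (here eq)))) = ≢ph (x-injective r k p h (neg-injective eq))

    Harmless : LitSet → Set
    Harmless D = (∃ λ l → l ∈ D × l ∈ complements L) → (∀ {l} → l ∈ D → l ∉ L) →
                 Tautological ((C ∖ L) ++ (D ∖ complements L))

    private
      clash-at : ∀ {D} r k → ¬ (r ≡ i × k ≡ j) → ¬ (r ≡ p × k ≡ h) →
                 pos (x r k) ∈ C → neg (x r k) ∈ D → Tautological ((C ∖ L) ++ (D ∖ complements L))
      clash-at r k ≢ij ≢ph pos∈ neg∈ = x r k ,
        ∈-++⁺ˡ (∈-filter⁺ (λ l → ¬? (l ∈? L)) pos∈ (pos∉L ≢ij ≢ph)) ,
        ∈-++⁺ʳ (C ∖ L) (∈-filter⁺ (λ l → ¬? (l ∈? complements L)) neg∈ (neg∉L̄ ≢ij ≢ph))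

      -- The exchange brings `q` into hole `k`. If `t` is the pigeon leaving that hole, `D` meets
      -- `L`. Otherwise `C` contains `x t k`, as it speaks of pigeons sitting alone, and this
      -- clashes with `D`.
      touched-hole : ∀ {D q t k} → q ≢ t → neg (x q k) ∈ D → neg (x t k) ∈ D → (∀ {l} → l ∈ D → l ∉ L) →
        neg (x q k) ≡ neg (x i j) ⊎ neg (x q k) ≡ neg (x p h) →
        Tautological ((C ∖ L) ++ (D ∖ complements L))
      touched-hole {q = q} {t} {k} q≢t q∈ t∈ D∩L=∅ (inj₁ eq) with x-injective q k i j (neg-injective eq)
      ... | refl , refl with t Fin.≟ p
      ...   | yes refl = contradiction (here refl) (D∩L=∅ t∈)
      ...   | no t≢p = clash-at t k (λ (t≡i , _) → q≢t (sym t≡i)) (λ (_ , j≡h) → h≢j (sym j≡h))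
                         (in-swap⁺ p h i j (column-j t t≢p)) t∈
      touched-hole {q = q} {t} {k} q≢t q∈ t∈ D∩L=∅ (inj₂ eq) with x-injective q k p h (neg-injective eq)
      ... | refl , refl with t Fin.≟ i
      ...   | yes refl = contradiction (there (here refl)) (D∩L=∅ t∈)
      ...   | no t≢i = clash-at t k (λ (_ , h≡j) → h≢j h≡j) (λ (t≡p , _) → q≢t (sym t≡p))
                         (in-swap⁺ p h i j (column-h t t≢i)) t∈

    -- A pigeon clause that loses `x p j` or `x i h` contains `x p h` or `x i j`, which lies in `L`.
    -- Hole clauses fall under `touched-hole`.
    shape-harmless : ∀ {D} → Shape {m} D → Harmless D
    shape-harmless {D} (pigeon r D≐) (l , l∈ , l∈L̄) D∩L=∅ with ∈-pigeonLits⁻ r (proj₁ D≐ l∈)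
    ... | k , refl with touched l∈L̄
    ...   | inj₁ eq with x-injective r k p j (pos-injective eq)
    ...     | refl , refl = contradiction ph∈L (D∩L=∅ (proj₂ D≐ (∈-pigeonLits⁺ p h)))
    shape-harmless {D} (pigeon r D≐) (l , l∈ , l∈L̄) D∩L=∅ | k , refl | inj₂ (inj₁ eq)
      with x-injective r k i h (pos-injective eq)
    ...     | refl , refl = contradiction ij∈L (D∩L=∅ (proj₂ D≐ (∈-pigeonLits⁺ i j)))
    shape-harmless {D} (pigeon r D≐) (l , l∈ , l∈L̄) D∩L=∅ | k , refl | inj₂ (inj₂ (inj₁ ()))
    shape-harmless {D} (pigeon r D≐) (l , l∈ , l∈L̄) D∩L=∅ | k , refl | inj₂ (inj₂ (inj₂ ()))
    shape-harmless {D} (hole r s k r≢s D≐) (l , l∈ , l∈L̄) D∩L=∅ = by (proj₁ D≐ l∈)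
      where
      r∈ : neg (x r k) ∈ D
      r∈ = proj₂ D≐ (here refl)
      s∈ : neg (x s k) ∈ D
      s∈ = proj₂ D≐ (there (here refl))
      negative : ∀ {v} → l ≡ neg v → neg v ≡ neg (x i j) ⊎ neg v ≡ neg (x p h)
      negative refl with touched l∈L̄
      ... | inj₂ (inj₂ eq) = eq
      by : l ∈ holeLits r s k → Tautological ((C ∖ L) ++ (D ∖ complements L))
      by (here refl)         = touched-hole r≢s r∈ s∈ D∩L=∅ (negative refl)
      by (there (here refl)) = touched-hole (r≢s ∘ sym) s∈ r∈ D∩L=∅ (negative refl)

    -- Since `a` is not `p`, column `h` contributes `x p h` to `D`, and this literal lies in `L`.
    same-stage-harmless : ∀ {D a b} → a ≢ p → D ≐ swapLits p h a b → Harmless D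
    same-stage-harmless {D} {a} {b} a≢p D≐ _ D∩L=∅ =
      contradiction ph∈L (D∩L=∅ (proj₂ D≐ (in-swap⁺ p h a b (column-h p (a≢p ∘ sym)))))

    -- As `q` and `g` differ from the pigeons and holes exchanged, contact is confined to column
    -- `b`, so `b` is `j` or `h`. That column then supplies `x i j` or `x p h`, both in `L`.
    earlier-stage-harmless : ∀ {D q g a b} → q ≢ p → q ≢ i → g ≢ h → g ≢ j →
                             D ≐ swapLits q g a b → Harmless D
    earlier-stage-harmless {D} {q} {g} {a} {b} q≢p q≢i g≢h g≢j D≐ (l , l∈ , l∈L̄) D∩L=∅ =
      ⊥-elim (absurd (in-swap⁻ q g a b (proj₁ D≐ l∈)) (touched l∈L̄))
      where
      D∌ : ∀ {l} → l ∈ L → InSwap q g a b l → ⊥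
      D∌ l∈L in-D = D∩L=∅ (proj₂ D≐ (in-swap⁺ q g a b in-D)) l∈L
      absurd : ∀ {l} → InSwap q g a b l →
        l ≡ pos (x p j) ⊎ l ≡ pos (x i h) ⊎ l ≡ neg (x i j) ⊎ l ≡ neg (x p h) → ⊥
      absurd cross-p (inj₂ (inj₂ (inj₁ eq))) = q≢i (proj₁ (x-injective q b i j (neg-injective eq)))
      absurd cross-p (inj₂ (inj₂ (inj₂ eq))) = q≢p (proj₁ (x-injective q b p h (neg-injective eq)))
      absurd cross-i (inj₂ (inj₂ (inj₁ eq))) = g≢j (proj₂ (x-injective a g i j (neg-injective eq)))
      absurd cross-i (inj₂ (inj₂ (inj₂ eq))) = g≢h (proj₂ (x-injective a g p h (neg-injective eq)))
      absurd (column-h r _) (inj₁ eq)        = g≢j (proj₂ (x-injective r g p j (pos-injective eq)))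
      absurd (column-h r _) (inj₂ (inj₁ eq)) = g≢h (proj₂ (x-injective r g i h (pos-injective eq)))
      absurd (column-h r _) (inj₂ (inj₂ (inj₁ ())))
      absurd (column-h r _) (inj₂ (inj₂ (inj₂ ())))
      absurd (column-j r _) (inj₂ (inj₂ (inj₁ ())))
      absurd (column-j r _) (inj₂ (inj₂ (inj₂ ())))
      absurd (column-j r _) (inj₁ eq) with x-injective r b p j (pos-injective eq)
      ... | _ , refl = D∌ ij∈L (column-j i (q≢i ∘ sym))
      absurd (column-j r _) (inj₂ (inj₁ eq)) with x-injective r b i h (pos-injective eq)
      ... | _ , refl = D∌ ph∈L (column-j p (q≢p ∘ sym))

    swap-setBlocked : ∀ {Γ} → (∀ D → D ∈ᶜ Γ → Harmless (lits D)) →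
                      SetBlocked (clause C (swap-consistent p i h≢j)) Γ
    swap-setBlocked harmless = L , (neg (x p j) , here refl) , L⊆C ,
      λ D D∈ touch disjoint → harmless D D∈ touch (λ l∈D l∈L → disjoint (l∈D , l∈L))
      where
      L⊆C : L ⊆ C
      L⊆C (here refl)                         = in-swap⁺ p h i j cross-p
      L⊆C (there (here refl))                 = in-swap⁺ p h i j cross-i
      L⊆C (there (there (here refl)))         = in-swap⁺ p h i j (column-j i i≢p)
      L⊆C (there (there (there (here refl)))) = in-swap⁺ p h i j (column-h p (i≢p ∘ sym))

-- The refutation in stages

module Refutation (m : ℕ) where

  open Extensions (vars (php m))

  -- Stage k moves pigeon k into hole k; pigeons and holes before k are settled.
  Later : Fin m → Fin (suc m) × Fin m → Set
  Later k (i , j) = toℕ k < toℕ i × toℕ k < toℕ j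

  later? : ∀ k ij → Dec (Later k ij)
  later? k (i , j) = (toℕ k <? toℕ i) ×-dec (toℕ k <? toℕ j)

  later-pigeon : ∀ {k : Fin m} {i : Fin (suc m)} → toℕ k < toℕ i → i ≢ inject₁ k
  later-pigeon {k} k<i refl = <-irrefl (sym (toℕ-inject₁ k)) k<i

  later-hole : ∀ {k j : Fin m} → toℕ k < toℕ j → k ≢ j
  later-hole k<j refl = <-irrefl refl k<j

  swapAt crossAt : Fin m → Fin (suc m) × Fin m → LitSet
  swapAt  k (i , j) = swapLits (inject₁ k) k i j
  crossAt k (i , j) = crossLits (inject₁ k) k i j

  -- Further clauses can destroy set-blockedness. All swap clauses are therefore introduced before
  -- any resolution, and every clause of the CNF is tracked.
  Known : ℕ → LitSet → Set
  Known q S = Shape {m} S ⊎ ∃₂ λ k ij → toℕ k < q × Later k ij × S ≐ swapAt k ij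

  AllKnown : ℕ → CNF → Set
  AllKnown q Δ = ∀ D → D ∈ᶜ Δ → Known q (lits D)

  Swapped : Fin m → Fin (suc m) × Fin m → CNF → Set
  Swapped k ij Δ = Later k ij → Has Δ (swapAt k ij)

  known-harmless : ∀ {k j : Fin m} {i : Fin (suc m)} {D} (k<i : toℕ k < toℕ i) (k<j : toℕ k < toℕ j) →
    Known (suc (toℕ k)) D → Harmless (later-pigeon k<i) (later-hole k<j) D
  known-harmless k<i k<j (inj₁ shape) = shape-harmless (later-pigeon k<i) (later-hole k<j) shape
  known-harmless {k} {j} {i} k<i k<j (inj₂ (g , (a , b) , g≤k , (g<a , g<b) , D≐))
    with m<1+n⇒m<n∨m≡n {n = toℕ k} g≤k
  ... | inj₁ g<k = earlier-stage-harmless (later-pigeon k<i) (later-hole k<j) {a = a} {b}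
    (λ eq → <-irrefl (trans (sym (toℕ-inject₁ g)) (trans (cong toℕ eq) (toℕ-inject₁ k))) g<k)
    (λ eq → <-irrefl (trans (sym (toℕ-inject₁ g)) (cong toℕ eq)) (<-trans g<k k<i))
    (λ eq → <-irrefl (cong toℕ eq) g<k)
    (λ eq → <-irrefl (cong toℕ eq) (<-trans g<k k<j)) D≐
  ... | inj₂ g≡k with toℕ-injective g≡k
  ...   | refl = same-stage-harmless (later-pigeon k<i) (later-hole k<j) {a = a} {b} (later-pigeon g<a) D≐

  cells : List (Fin (suc m) × Fin m)
  cells = cartesianProduct (allFin (suc m)) (allFin m)

  swap-stage : ∀ k {Γ} ijs → AllKnown (suc (toℕ k)) Γ →
    Reach Γ (length ijs) (λ Δ → AllKnown (suc (toℕ k)) Δ × (∀ {ij} → ij ∈ ijs → Swapped k ij Δ))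
  swap-stage k []               known = reach-here (known , λ ())
  swap-stage k {Γ} (ij ∷ ijs) known with later? k ij
  ... | no ¬later = reach-map
    (λ (known′ , swapped) → known′ , λ { (here refl) later → contradiction later ¬later ; (there ij∈) → swapped ij∈ })
    (reach-≤ (n≤1+n _) (swap-stage k ijs known))
  ... | yes later@(k<i , k<j) with swap-stage k ijs known′
    where
    E : Clause
    E = clause (swapAt k ij) (swap-consistent (inject₁ k) (proj₁ ij) (later-hole k<j))
    known′ : AllKnown (suc (toℕ k)) (E ∷ Γ)
    known′ D (here D≐E) = inj₂ (k , ij , ≤-refl , later , D≐E)
    known′ D (there D∈) = known D D∈
  ...   | N , Δ , N≤ , γ , known″ , swapped =
    suc N , Δ , s≤s N≤ ,
    step _ (setBlocked (swap-setBlocked (later-pigeon k<i) (later-hole k<j)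
                         λ D D∈ → known-harmless k<i k<j (known D D∈)))
           (cells-vars (swap-cells (inject₁ k) k (proj₁ ij) (proj₂ ij))) γ ,
    known″ , λ { (here refl) _ → extends-has γ (here ≐-refl) ; (there ij∈) → swapped ij∈ }

  swap-phase : ∀ q → q ≤ m →
    Reach (php m) (q * length cells) (λ Δ → AllKnown q Δ × (∀ k ij → toℕ k < q → Swapped k ij Δ))
  swap-phase zero    _   = reach-here ((λ D D∈ → inj₁ (php-shape D∈)) , λ _ _ ())
  swap-phase (suc q) q<m = reach-≤ (≤-reflexive (+-comm (q * length cells) (length cells)))
    (reach-bind (swap-phase q (<⇒≤ q<m)) λ γ (known , swapped) →
      reach-extends (swap-stage k cells (λ D D∈ → widen (known D D∈))) λ δ (known′ , swapped′) →
        subst (λ q → AllKnown (suc q) _) k≡q known′ ,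
        λ k′ ij k′≤q → [ (λ k′<q later → extends-has δ (swapped k′ ij k′<q later))
                       , (λ k′≡q → subst (λ k → Swapped k ij _) (toℕ-injective (trans k≡q (sym k′≡q)))
                                     (swapped′ (∈-cartesianProduct⁺ (∈-allFin _) (∈-allFin _)))) ]′
                       (m<1+n⇒m<n∨m≡n k′≤q))
    where
    k : Fin m
    k = fromℕ< q<m
    k≡q : toℕ k ≡ q
    k≡q = toℕ-fromℕ< q<m
    widen : ∀ {S} → Known q S → Known (suc (toℕ k)) S
    widen = Sum.map₂ λ (g , ij , g<q , rest) →
      g , ij , <-trans g<q (subst (_< suc (toℕ k)) k≡q ≤-refl) , rest

  Crossed : Fin m × Fin (suc m) × Fin m → CNF → Set
  Crossed (k , ij) Δ = Later k ij → Has Δ (crossAt k ij)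

  Base : CNF → Set
  Base Δ = ∀ {S} → Has (php m) S → Has Δ S

  length-others : ∀ p j → length (others {m} p j) ≡ m
  length-others p j = trans (length-map _ (allFin m)) (length-tabulate {n = m} id)

  -- The positive literals of each column are resolved away against hole clauses with the crossing
  -- literal of that column. What remains forbids pigeon `k` in hole `j` together with pigeon `i` in
  -- hole `k`, whoever else is there.
  cross-out : ∀ {Δ} k ij → Base Δ → Swapped k ij Δ → Reach Δ (suc (m + m)) (Crossed (k , ij))
  cross-out k ij@(i , j) base swapped with later? k ij
  ... | no ¬later = reach-here λ later → contradiction later ¬later
  ... | yes later@(k<i , k<j) = reach-map (λ h _ → h) (reach-≤ (≤-reflexive (cong suc lengths))
    (eliminate (swapAt k ij) (crossAt k ij) (swapVars p k i j)
      (cells-vars (swap-cells p k i j)) (swap-consistent p i (later-hole k<j))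
      (swapped later) id cuts))
    where
    p = inject₁ k
    lengths : length (swapVars p k i j) ≡ m + m
    lengths = trans (length-++ (others p j)) (cong₂ _+_ (length-others p j) (length-others i k))
    cuts : Cuts _ (crossAt k ij) (swapVars p k i j)
    cuts u∈ with ∈-++⁻ (others p j) u∈
    ... | inj₁ u∈j with ∈-others⁻ p j u∈j
    ...   | r , r≢p , refl = neg (x p j) ∷ [] , (λ { (here refl) → here refl }) , base (php-hole j r≢p)
    cuts u∈ | inj₂ u∈k with ∈-others⁻ i k u∈k
    ...   | r , r≢i , refl = neg (x i k) ∷ [] , (λ { (here refl) → there (here refl) }) , base (php-hole k r≢i)

  cols : ℕ → List (Fin m)
  cols q = filter (λ j → q ≤? toℕ j) (allFin m)

  rowVars : ℕ → Fin (suc m) → List Var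
  rowVars q r = map (x r) (cols q)

  rowLits : ℕ → Fin (suc m) → LitSet
  rowLits q r = map pos (rowVars q r)

  ∈-rowVars⁻ : ∀ q r {v} → v ∈ rowVars q r → ∃ λ j → q ≤ toℕ j × v ≡ x r j
  ∈-rowVars⁻ q r v∈ with ∈-map⁻ (x r) v∈
  ... | j , j∈ , refl = j , proj₂ (∈-filter⁻ (λ j → q ≤? toℕ j) {xs = allFin m} j∈) , refl

  ∈-rowLits⁺ : ∀ q r j → q ≤ toℕ j → pos (x r j) ∈ rowLits q r
  ∈-rowLits⁺ q r j q≤j = ∈-map⁺ pos (∈-map⁺ (x r) (∈-filter⁺ (λ j → q ≤? toℕ j) (∈-allFin j) q≤j))

  ∈-rowLits⁻ : ∀ q r {l} → l ∈ rowLits q r → ∃ λ j → q ≤ toℕ j × l ≡ pos (x r j)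
  ∈-rowLits⁻ q r l∈ with ∈-map⁻ pos l∈
  ... | v , v∈ , refl with ∈-rowVars⁻ q r v∈
  ...   | j , q≤j , refl = j , q≤j , refl

  length-rowVars : ∀ q r → length (rowVars q r) ≤ m
  length-rowVars q r = begin
    length (rowVars q r)     ≡⟨ length-map (x r) (cols q) ⟩
    length (cols q)          ≤⟨ length-filter (λ j → q ≤? toℕ j) (allFin m) ⟩
    length (allFin m)        ≡⟨ length-tabulate {n = m} id ⟩
    m                        ∎
    where open ≤-Reasoning

  Row : ℕ → Fin (suc m) → CNF → Set
  Row q i Δ = q ≤ toℕ i → Has Δ (rowLits q i)

  -- Wherever pigeon `k` sits among its remaining holes, pigeon `i` cannot be in hole `k`: for hole
  -- `k` itself by a hole clause, for a later hole by a crossing clause. The resulting unit clause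
  -- cuts `x i k` from the row of `i`.
  shrink-row : ∀ {Δ} (k : Fin m) i → Base Δ → (∀ j → Crossed (k , i , j) Δ) →
    (∀ i → Row (toℕ k) i Δ) → Reach Δ (suc m + 2) (Row (suc (toℕ k)) i)
  shrink-row {Δ} k i base crossed rows with toℕ k <? toℕ i
  ... | no k≮i  = reach-here λ k<i → contradiction k<i k≮i
  ... | yes k<i = reach-bind
    (reach-≤ (s≤s (length-rowVars q p))
      (eliminate (rowLits q p) (neg (x i k) ∷ []) (rowVars q p) (cells-vars vacate-cells) vacate-consistent
        (rows p (≤-reflexive (sym (toℕ-inject₁ k)))) there vacate-cuts))
    λ γ vacated → reach-map (λ h _ → h)
      (eliminate (rowLits q i) (rowLits (suc q) i) (x i k ∷ []) (cells-vars row-cells) row-consistent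
        (extends-has γ (rows i (<⇒≤ k<i))) row-split
        λ { (here refl) → [] , (λ ()) , vacated })
    where
    q = toℕ k
    p = inject₁ k

    vacate-cells : InCells (neg (x i k) ∷ rowLits q p)
    vacate-cells (here refl) = i , k , refl
    vacate-cells (there l∈) with ∈-rowLits⁻ q p l∈
    ... | j , _ , refl = p , j , refl

    vacate-consistent : ¬ Tautological (neg (x i k) ∷ rowLits q p)
    vacate-consistent (v , there v∈ , here refl) with ∈-rowLits⁻ q p v∈
    ... | j , _ , eq = later-pigeon k<i (proj₁ (x-injective i k p j (pos-injective eq)))
    vacate-consistent (v , _ , there v̄∈) with ∈-rowLits⁻ q p v̄∈
    ... | _ , _ , ()

    vacate-cuts : Cuts Δ (neg (x i k) ∷ []) (rowVars q p)
    vacate-cuts u∈ with ∈-rowVars⁻ q p u∈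
    ... | j , q≤j , refl with m≤n⇒m<n∨m≡n q≤j
    ...   | inj₁ q<j = neg (x i k) ∷ [] , id , crossed j (k<i , q<j)
    ...   | inj₂ q≡j with toℕ-injective q≡j
    ...     | refl = neg (x i k) ∷ [] , id , base (php-hole k (later-pigeon k<i ∘ sym))

    row-split : rowLits q i ⊆ rowLits (suc q) i ++ pos (x i k) ∷ []
    row-split l∈ with ∈-rowLits⁻ q i l∈
    ... | j , q≤j , refl with m≤n⇒m<n∨m≡n q≤j
    ...   | inj₁ q<j = ∈-++⁺ˡ (∈-rowLits⁺ (suc q) i j q<j)
    ...   | inj₂ q≡j with toℕ-injective q≡j
    ...     | refl = ∈-++⁺ʳ (rowLits (suc q) i) (here refl)

    row⁻ : ∀ {l} → l ∈ rowLits (suc q) i ++ pos (x i k) ∷ [] → ∃ λ j → l ≡ pos (x i j)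
    row⁻ l∈ with ∈-++⁻ (rowLits (suc q) i) l∈
    ... | inj₂ (here refl) = k , refl
    ... | inj₁ l∈row with ∈-rowLits⁻ (suc q) i l∈row
    ...   | j , _ , eq = j , eq

    row-cells : InCells (rowLits (suc q) i ++ pos (x i k) ∷ [])
    row-cells l∈ with row⁻ l∈
    ... | j , refl = i , j , refl

    row-consistent : ¬ Tautological (rowLits (suc q) i ++ pos (x i k) ∷ [])
    row-consistent (_ , _ , v̄∈) with row⁻ v̄∈
    ... | _ , ()

  rowsCost : ℕ
  rowsCost = length (allFin (suc m)) * (suc m + 2)

  row-phase : ∀ {Γ} q → q ≤ m → Base Γ → (∀ kij → Crossed kij Γ) →
    Reach Γ (q * rowsCost) (λ Δ → ∀ i → Row q i Δ)
  row-phase zero    _   base crossed = reach-here λ i _ → has-resp-≐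
    ( (λ l∈ → let j , eq = ∈-pigeonLits⁻ i l∈ in subst (_∈ rowLits 0 i) (sym eq) (∈-rowLits⁺ 0 i j z≤n))
    , (λ l∈ → let j , _ , eq = ∈-rowLits⁻ 0 i l∈ in subst (_∈ pigeonLits i) (sym eq) (∈-pigeonLits⁺ i j)))
    (base (php-pigeon i))
  row-phase (suc q) q<m base crossed = reach-≤ (≤-reflexive (+-comm (q * rowsCost) rowsCost))
    (reach-bind (row-phase q (<⇒≤ q<m) base crossed) λ γ rows →
      reach-map (λ rows′ i → subst (λ q → Row (suc q) i _) k≡q (rows′ (∈-allFin i)))
        (reach-each (allFin (suc m)) (λ _ δ row le → extends-has δ (row le)) λ i δ →
          shrink-row k i (extends-has δ ∘ extends-has γ ∘ base)
            (λ j later → extends-has δ (extends-has γ (crossed (k , i , j) later)))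
            (λ i le → extends-has δ (subst (λ q → Row q i _) (sym k≡q) (rows i) le))))
    where
    k : Fin m
    k = fromℕ< q<m
    k≡q : toℕ k ≡ q
    k≡q = toℕ-fromℕ< q<m

  triples : List (Fin m × Fin (suc m) × Fin m)
  triples = cartesianProduct (allFin m) cells

  refutation : Reach (php m) (m * length cells + (length triples * suc (m + m) + m * rowsCost)) (λ Δ → Has Δ [])
  refutation = reach-bind (swap-phase m ≤-refl) λ γ (_ , swapped) →
    reach-bind
      (reach-each triples (λ _ δ crossed later → extends-has δ (crossed later)) λ (k , ij) δ →
        cross-out k ij (extends-has δ ∘ extends-has γ)
          (λ later → extends-has δ (swapped k ij (toℕ<n k) later)))
      λ δ crossed → reach-map
        -- Pigeon `fromℕ m` is the only one left after all `m` stages, and no hole has index `m` or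
        -- more, so its row is the empty clause.
        (λ rows → has-resp-≐ (empty , λ ()) (rows (fromℕ m) (≤-reflexive (sym (toℕ-fromℕ m)))))
        (row-phase m ≤-refl (extends-has δ ∘ extends-has γ)
          λ (k , i , j) → crossed (∈-cartesianProduct⁺ (∈-allFin k) (∈-cartesianProduct⁺ (∈-allFin i) (∈-allFin j))))
    where
    empty : rowLits m (fromℕ m) ⊆ []
    empty l∈ with ∈-rowLits⁻ m (fromℕ m) l∈
    ... | j , m≤j , _ = contradiction (toℕ<n j) (≤⇒≯ m≤j)

-- Polynomial size and the separation

length-cartesianProduct : ∀ {A B : Set} (xs : List A) (ys : List B) →
  length (cartesianProduct xs ys) ≡ length xs * length ys
length-cartesianProduct []       ys = refl
length-cartesianProduct (x ∷ xs) ys = trans (length-++ (map (x ,_) ys))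
  (cong₂ _+_ (length-map (x ,_) ys) (length-cartesianProduct xs ys))

quartic-bound : ∀ m → 1 ≤ m →
  suc (m * (suc m * m) + (m * (suc m * m) * suc (m + m) + m * (suc m * (suc m + 2)))) ≤ 17 * m ^ 4
quartic-bound m 1≤m = begin
  suc (m * (suc m * m) + (m * (suc m * m) * suc (m + m) + m * (suc m * (suc m + 2))))
    -- Using `1 ≤ m`, each summand is padded to degree four; the coefficients 1, 2, 6 and 8 add up
    -- to 17.
    ≤⟨ +-mono-≤ (≤-trans 1≤m (m≤m*n m (m * m * m) {{>-nonZero (*-mono-≤ (*-mono-≤ 1≤m 1≤m) 1≤m)}}))
                (+-mono-≤ (≤-trans triple-bound (m≤m*n _ m {{>-nonZero 1≤m}}))
                  (+-mono-≤ (*-mono-≤ triple-bound (+-monoˡ-≤ (m + m) 1≤m))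
                    (≤-trans (*-monoʳ-≤ m (*-mono-≤ suc≤ (+-mono-≤ suc≤ (+-mono-≤ 1≤m 1≤m))))
                             (m≤m*n _ m {{>-nonZero 1≤m}})))) ⟩
  m * (m * m * m) + (m * ((m + m) * m) * m + (m * ((m + m) * m) * (m + (m + m)) + m * ((m + m) * (m + m + (m + m))) * m))
    ≡⟨ collect m ⟩
  17 * (m * (m * (m * (m * 1)))) ∎
  where
  open ≤-Reasoning
  suc≤ : suc m ≤ m + m
  suc≤ = +-monoˡ-≤ m 1≤m
  triple-bound : m * (suc m * m) ≤ m * ((m + m) * m)
  triple-bound = *-monoʳ-≤ m (*-monoˡ-≤ m suc≤)
  collect : ∀ m → m * (m * m * m) + (m * ((m + m) * m) * m + (m * ((m + m) * m) * (m + (m + m)) + m * ((m + m) * (m + m + (m + m))) * m))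
                ≡ 17 * (m * (m * (m * (m * 1))))
  collect = solve-∀

sbc-upper-bound : ∀ m → 1 ≤ m → ∃ λ N → SBC⁻Proof (php m) N × N ≤ 17 * m ^ 4
sbc-upper-bound m 1≤m with Refutation.refutation m
... | N , Δ , N≤ , γ , ⊥∈ =
  suc N , Extensions.extends-proof (vars (php m)) id γ ⊥∈ , ≤-trans (s≤s N≤)
    (≤-trans (≤-reflexive (cong suc (cong₂ _+_ (cong (m *_) cells-length)
      (cong₂ _+_ (cong (_* suc (m + m)) (trans (length-cartesianProduct (allFin m) cells) (cong₂ _*_ (length-tabulate {n = m} id) cells-length)))
                 (cong (λ l → m * (l * (suc m + 2))) (length-tabulate {n = suc m} id))))))
      (quartic-bound m 1≤m))
  where
  open Refutation m
  cells-length : length cells ≡ suc m * m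
  cells-length = trans (length-cartesianProduct (allFin (suc m)) (allFin m))
    (cong₂ _*_ (length-tabulate {n = suc m} id) (length-tabulate {n = m} id))

rescale : ∀ {Q : ℕ → ℕ → Set} a b k →
  (∀ n → 1 ≤ n → ∃ λ N → Q n N × N ≤ a * (b * n) ^ k) →
  ∃₂ λ c k → ∀ n → 1 ≤ n → ∃ λ N → Q n N × N ≤ c * n ^ k
rescale a b k bound = a * b ^ k , k , λ n 1≤n → let N , q , N≤ = bound n 1≤n in
  N , q , ≤-trans N≤
    (≤-reflexive (trans (cong (a *_) (^-distribʳ-* k b n)) (sym (*-assoc a (b ^ k) (n ^ k)))))

theorem1p5 : Σ (ℕ → CNF) λ Γ →
    (∃₂ λ c k → ∀ n → 1 ≤ n → ∃ λ N → SBC⁻Proof (Γ n) N × N ≤ c * n ^ k)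
    ×
    (∃₂ λ d n₀ → 1 ≤ d × (∀ n → 1 ≤ n → n₀ ≤ n → (π : GER⁻Proof (Γ n)) → 2 ^ n ≤ GER⁻Proof.size π ^ d))
theorem1p5 =
  (λ n → php (4 * n)) ,
  rescale {λ n → SBC⁻Proof (php (4 * n))} 17 4 4 (λ n 1≤n → sbc-upper-bound (4 * n) (≤-trans 1≤n (m≤m+n n _))) ,
  -- The bound by a 14th power says that the size is at least 2 to the power `n / 14`.
  (14 , 1 , s≤s z≤n , λ n 1≤n _ → ger-lower-bound n 1≤n)
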